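{- Let $k>d\geq 2$ be integers. The competitive ratio of the \textsc{Ranking} algorithm for online bipartite matching on $(k,d)$-bounded graphs is at most $$1-\frac{(1-1/d)^k\cdot(d-1)}{k+d-1}.$$
   Context: Online bipartite matching: offline servers $S$, online requests $R$ arriving one at a time in adversarial order; on arrival of $r$ its neighbors are revealed and the algorithm irrevocably matches $r$ to an unmatched neighbor or leaves it unmatched. Competitive ratio on a class of instances: infimum of $\mathbb{E}[\mathsf{ALG}]/\mathsf{OPT}$, with $\mathsf{ALG}$ the produced matching size and $\mathsf{OPT}$ the maximum matching size. A bipartite graph is $(k,d)$-bounded if every server has degree at least $k$ and every request has degree at most $d$. \textsc{Ranking}: each server independently draws a rank uniformly from $[0,1]$; each arriving request is matched to its unmatched neighbor of smallest rank, if any. -}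

module Defs where

open import Data.Bool using (Bool; true; false; _∧_; _∨_; if_then_else_; not)
open import Data.Product using (_×_)
open import Relation.Binary.PropositionalEquality using (_≡_)
open import Data.Nat using (ℕ; zero; suc; _+_; _*_; _∸_; _^_; _≤_; _<_)
open import Data.Fin using (Fin; zero; suc; toℕ; _≟_)
open import Data.Maybe using (Maybe; just; nothing)
open import Data.List using (List; []; _∷_; map; concatMap; foldr; length; filterᵇ)
open import Data.Nat.ListAction using (sum)
open import Data.Vec.Functional using (Vector)
import Data.Vec.Functional as VF
open import Data.Integer using (+_)
open import Data.Rational using (ℚ; _/_; _-_; 1ℚ; 0ℚ)
open import Relation.Nullary.Decidable using (⌊_⌋)
open import Data.Nat using (_<ᵇ_)

countTrue : ∀ {n} → (Fin n → Bool) → ℕ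
countTrue {zero}  p = 0
countTrue {suc n} p = (if p zero then 1 else 0) + countTrue (λ i → p (suc i))

allFin : (n : ℕ) → List (Fin n)
allFin zero    = []
allFin (suc n) = zero ∷ map suc (allFin n)

allB : ∀ {n} → (Fin n → Bool) → Bool
allB {n} p = foldr (λ i b → p i ∧ b) true (allFin n)

-- total division into ℚ (0 if the denominator is 0); only used with
-- nonzero denominators
_/ℕ_ : ℕ → ℕ → ℚ
a /ℕ zero  = 0ℚ
a /ℕ suc b = (+ a) / suc b

-- Instances of online bipartite matching.
-- Servers are Fin nS, requests are Fin nR; requests arrive in the order
-- zero, 1, 2, ... (the adversarial arrival order is part of the instance).
-- adj r s = true iff request r and server s are adjacent.

record Instance : Set where
  field
    nS  : ℕ
    nR  : ℕ
    adj : Fin nR → Fin nS → Bool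
open Instance public

degServer : (I : Instance) → Fin (nS I) → ℕ
degServer I s = countTrue (λ r → adj I r s)

degRequest : (I : Instance) → Fin (nR I) → ℕ
degRequest I r = countTrue (λ s → adj I r s)

Bounded : ℕ → ℕ → Instance → Set
Bounded k d I = (∀ s → k ≤ degServer I s) × (∀ r → degRequest I r ≤ d)

isJust : ∀ {A : Set} → Maybe A → Bool
isJust (just _) = true
isJust nothing  = false

record Matching (I : Instance) : Set where
  field
    mate     : Fin (nR I) → Maybe (Fin (nS I))
    edge     : ∀ r s → mate r ≡ just s → adj I r s ≡ true
    injMate  : ∀ r r' s → mate r ≡ just s → mate r' ≡ just s → r ≡ r'
open Matching public

size : ∀ {I} → Matching I → ℕ
size M = countTrue (λ r → isJust (mate M r))

IsMaximum : ∀ {I} → Matching I → Set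
IsMaximum {I} M = ∀ (M' : Matching I) → size M' ≤ size M

-- Ranking.  A ranking is an injective map rank : Fin n → Fin n
-- (a uniformly random bijection of the servers to ranks; this is the
-- distribution of the rank order induced by i.i.d. U[0,1] ranks, which
-- have no ties almost surely).

pick : ∀ {n} → (Fin n → Fin n) → (Fin n → Bool) → Maybe (Fin n)
pick {n} rank ok = foldr step nothing (allFin n)
  where
  step : Fin _ → Maybe (Fin _) → Maybe (Fin _)
  step s best with ok s
  ... | false = best
  ... | true with best
  ...   | nothing = just s
  ...   | just t  = if toℕ (rank s) <ᵇ toℕ (rank t) then just s else just t

runRanking : ∀ {n m} → (Fin n → Fin n) → (Fin m → Fin n → Bool)
           → (Fin n → Bool) → ℕ
runRanking {n} {zero}  rank adj' matched = 0
runRanking {n} {suc m} rank adj' matched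
  with pick rank (λ s → adj' zero s ∧ not (matched s))
... | nothing = runRanking rank (λ r → adj' (suc r)) matched
... | just s  = suc (runRanking rank (λ r → adj' (suc r))
                       (λ t → matched t ∨ ⌊ t ≟ s ⌋))

allFuns : (n m : ℕ) → List (Fin n → Fin m)
allFuns zero    m = (λ ()) ∷ []
allFuns (suc n) m =
  concatMap (λ f → map (λ i → i VF.∷ f) (allFin m)) (allFuns n m)

injectiveB : ∀ {n} → (Fin n → Fin n) → Bool
injectiveB f = allB (λ i → allB (λ j → not ⌊ f i ≟ f j ⌋ ∨ ⌊ i ≟ j ⌋))

allRankings : (n : ℕ) → List (Fin n → Fin n)
allRankings n = filterᵇ injectiveB (allFuns n n)

expectedRanking : Instance → ℚ
expectedRanking I =
  sum (map (λ rank → runRanking rank (adj I) (λ _ → false)) (allRankings (nS I)))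
  /ℕ length (allRankings (nS I))

-- the bound 1 - (1 - 1/d)^k (d-1)/(k+d-1) = 1 - (d-1)^k (d-1) / (d^k (k+d-1))
bound : ℕ → ℕ → ℚ
bound k d = 1ℚ - (((d ∸ 1) ^ k * (d ∸ 1)) /ℕ (d ^ k * (k + d ∸ 1)))

ℕtoℚ : ℕ → ℚ
ℕtoℚ n = n /ℕ 1

{-# OPTIONS --safe #-}

-- Let N = d − 1. There are N "target" servers and k "companion" servers; request i of the first k
-- requests is adjacent to all targets and to companion i, and all later requests have a single
-- companion as neighbour. A request of the first round goes to the free target of least rank unless
-- its companion has smaller rank, and OPT = k + N since every server can be matched.
--
-- Let f(N,k) be the expected number of targets left unmatched, in the presence of e further inert
-- servers. The server of least rank is a companion, a target or inert. In the first case its request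
-- is lost for the targets, in the second the target takes the first request, whose companion becomes
-- inert, and what remains is again uniformly ordered:
--   (N + k + e) f(N,k) = k f(N,k−1) + N f(N−1,k−1) + e f(N,k).
-- By Bernoulli's inequality (1 − 1/N²)ᵏ ≥ 1 − k/N² this gives f(N,k) ≥ N (N/(N+1))ᵏ by induction,
-- and f(N,k) / (k+N) is the fraction of OPT that Ranking loses.

module Submission where

open import Defs
open import Data.Nat using (ℕ; _≤_; _<_)
open import Data.Product using (Σ; _×_)

module HardInstances where

  open import Data.Bool using (Bool; true; false; _∧_; _∨_; if_then_else_; not)
  open import Data.Bool.Properties using (∧-identityʳ; ∧-zeroʳ; ∨-zeroʳ; T-≡; ¬-not)
  open import Data.Fin using (Fin; zero; suc; toℕ; _≟_; punchOut; _↑ˡ_; _↑ʳ_; splitAt; join; combine; remQuot; inject≤)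
  open import Data.Fin.Properties using
    (punchOut-injective; toℕ-injective; any?; remQuot-combine; combine-injectiveˡ; combine-injectiveʳ;
     splitAt-↑ʳ; join-splitAt; ↑ˡ-injective; inject≤-injective)
    renaming (suc-injective to sucF-injective; 0≢1+n to zero≢suc)
  open import Data.List as List using (List; []; _∷_; foldr; filterᵇ; concatMap; length)
  open import Data.List.Membership.Propositional using (_∈_; _∉_)
  open import Data.List.Membership.Propositional.Properties using (∈-map⁺)
  open import Data.List.Properties using (length-map; map-++; map-∘; map-cong)
  open import Data.List.Relation.Unary.All as All using (All; []; _∷_)
  open import Data.List.Relation.Unary.AllPairs using (AllPairs; []; _∷_)
  open import Data.List.Relation.Unary.Any using (here; there)
  open import Data.Maybe using (Maybe; just; nothing)
  open import Data.Nat hiding (_≟_)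
  open import Data.Nat.ListAction using () renaming (sum to sumL)
  open import Data.Nat.ListAction.Properties using (sum-++)
  open import Data.Nat.Properties hiding (_≟_)
  open import Data.Nat.Tactic.RingSolver using (solve-∀)
  open import Data.Product using (Σ; ∃; _×_; _,_; proj₁; proj₂)
  open import Data.Sum using (_⊎_; inj₁; inj₂)
  open import Data.Vec as Vec using (Vec; []; _∷_; lookup; insertAt; removeAt; _++_; replicate)
  open import Data.Vec.Properties using (lookup-++ˡ; lookup-++ʳ; lookup-replicate)
  import Data.Vec.Functional as VF
  open import Function using (_∘_; Equivalence)
  open import Relation.Binary.PropositionalEquality
  open import Relation.Nullary using (yes; no; contradiction)
  open import Relation.Nullary.Decidable using (⌊_⌋)
  open import Algebra.Properties.CommutativeMonoid.Sum +-0-commutativeMonoid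
    using (sum; sum-cong-≗; ∑-distrib-+; ∑-comm)
  open import Algebra.Properties.CommutativeSemigroup +-commutativeSemigroup
    using () renaming (interchange to +-interchange; x∙yz≈y∙xz to x+[y+z]≡y+[x+z])
  open import Algebra.Properties.CommutativeSemigroup *-commutativeSemigroup
    using () renaming (interchange to *-interchange; x∙yz≈y∙xz to x*[y*z]≡y*[x*z])

  private
    variable
      n : ℕ

  -- Sums over injections

  indicator : Bool → ℕ
  indicator b = if b then 1 else 0

  ∑-mono-≤ : ∀ n {f g : Fin n → ℕ} → (∀ i → f i ≤ g i) → sum {n} f ≤ sum {n} g
  ∑-mono-≤ zero    f≤g = z≤n
  ∑-mono-≤ (suc n) f≤g = +-mono-≤ (f≤g zero) (∑-mono-≤ n (f≤g ∘ suc))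

  ∑-*ˡ : ∀ n c (f : Fin n → ℕ) → sum {n} (λ i → c * f i) ≡ c * sum {n} f
  ∑-*ˡ zero    c f = sym (*-zeroʳ c)
  ∑-*ˡ (suc n) c f = trans (cong (c * f zero +_) (∑-*ˡ n c (f ∘ suc))) (sym (*-distribˡ-+ c (f zero) _))

  ∑-const : ∀ n c → sum {n} (λ _ → c) ≡ n * c
  ∑-const zero    c = refl
  ∑-const (suc n) c = cong (c +_) (∑-const n c)

  ∑-zero : ∀ n {f : Fin n → ℕ} → (∀ i → f i ≡ 0) → sum {n} f ≡ 0
  ∑-zero n f≡0 = trans (sum-cong-≗ {n} f≡0) (trans (∑-const n 0) (*-zeroʳ n))

  -- ∑ⱽ n m sums over the vectors in {0,…,m−1}ⁿ, and ∑ᴵ n m over those without repetition.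
  ∑ⱽ : (n m : ℕ) → (Vec ℕ n → ℕ) → ℕ
  ∑ⱽ zero    m h = h []
  ∑ⱽ (suc n) m h = sum {m} λ v → ∑ⱽ n m (λ l → h (toℕ v ∷ l))

  ∑ⱽ-cong : (n m : ℕ) {h h′ : Vec ℕ n → ℕ} → h ≗ h′ → ∑ⱽ n m h ≡ ∑ⱽ n m h′
  ∑ⱽ-cong zero    m h≗h′ = h≗h′ []
  ∑ⱽ-cong (suc n) m h≗h′ = sum-cong-≗ {m} (λ v → ∑ⱽ-cong n m (λ l → h≗h′ (toℕ v ∷ l)))

  ∑ⱽ-zero : (n m : ℕ) {h : Vec ℕ n → ℕ} → (∀ l → h l ≡ 0) → ∑ⱽ n m h ≡ 0
  ∑ⱽ-zero zero    m h≡0 = h≡0 []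
  ∑ⱽ-zero (suc n) m h≡0 =
    ∑-zero m (λ v → ∑ⱽ-zero n m (λ l → h≡0 (toℕ v ∷ l)))

  ∑ⱽ-*ˡ : (n m c : ℕ) (h : Vec ℕ n → ℕ) → ∑ⱽ n m (λ l → c * h l) ≡ c * ∑ⱽ n m h
  ∑ⱽ-*ˡ zero    m c h = refl
  ∑ⱽ-*ˡ (suc n) m c h = trans (sum-cong-≗ {m} (λ v → ∑ⱽ-*ˡ n m c (λ l → h (toℕ v ∷ l)))) (∑-*ˡ m c _)

  ∑ⱽ-∑-comm : (n m : ℕ) {k : ℕ} (h : Fin k → Vec ℕ n → ℕ) →
    sum {k} (λ v → ∑ⱽ n m (h v)) ≡ ∑ⱽ n m (λ l → sum {k} (λ v → h v l))
  ∑ⱽ-∑-comm zero    m h = refl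
  ∑ⱽ-∑-comm (suc n) m {k} h =
    trans (∑-comm {k} {m} (λ v w → ∑ⱽ n m (λ l → h v (toℕ w ∷ l))))
          (sum-cong-≗ {m} (λ w → ∑ⱽ-∑-comm n m (λ v l → h v (toℕ w ∷ l))))

  mem : ∀ {n} → ℕ → Vec ℕ n → Bool
  mem v []      = false
  mem v (x ∷ l) = (v ≡ᵇ x) ∨ mem v l

  -- True when 0 occurs at least twice. This is the one failure of distinctness that obstructs
  -- splitting a sum by the position of 0.
  repeats-zero : ∀ {n} → Vec ℕ n → Bool
  repeats-zero []          = false
  repeats-zero (zero  ∷ l) = mem 0 l
  repeats-zero (suc _ ∷ l) = repeats-zero l

  -- Summands with an entry 0 vanish, and the other entries are exactly the successors of values
  -- below m.
  ∑ⱽ-avoiding-zero : (n m : ℕ) (h : Vec ℕ n → ℕ) → (∀ l → mem 0 l ≡ true → h l ≡ 0) →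
    ∑ⱽ n (suc m) h ≡ ∑ⱽ n m (h ∘ Vec.map suc)
  ∑ⱽ-avoiding-zero zero    m h h0 = refl
  ∑ⱽ-avoiding-zero (suc n) m h h0 = cong₂ _+_
    (∑ⱽ-zero n (suc m) (λ l → h0 (0 ∷ l) refl))
    (sum-cong-≗ {m} (λ v → ∑ⱽ-avoiding-zero n m _ (λ l → h0 (suc (toℕ v) ∷ l))))

  -- Splits by the position of the entry 0, which is unique on the support of h.
  ∑ⱽ-split-zero : (n m : ℕ) (h : Vec ℕ (suc n) → ℕ) → (∀ l → repeats-zero l ≡ true → h l ≡ 0) →
    ∑ⱽ (suc n) (suc m) h ≡
    ∑ⱽ (suc n) m (h ∘ Vec.map suc) + sum {suc n} (λ i → ∑ⱽ n m (λ l → h (insertAt (Vec.map suc l) i 0)))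
  ∑ⱽ-split-zero zero    m h h0 = begin
    h (0 ∷ []) + b         ≡⟨ +-comm (h (0 ∷ [])) b ⟩
    b + h (0 ∷ [])         ≡⟨ cong (b +_) (+-identityʳ _) ⟨
    b + (h (0 ∷ []) + 0)  ∎
    where
    open ≡-Reasoning
    b = sum {m} (λ v → h (suc (toℕ v) ∷ []))
  ∑ⱽ-split-zero (suc n) m h h0 = begin
    ∑ⱽ (suc n) (suc m) (λ l → h (0 ∷ l)) + sum {m} (λ v → ∑ⱽ (suc n) (suc m) (λ l → h (suc (toℕ v) ∷ l)))
      -- A leading 0 must be the only one, so the tail avoids 0; a positive head leaves the 0 to the
      -- tail, where the induction hypothesis applies.
      ≡⟨ cong₂ _+_ (∑ⱽ-avoiding-zero (suc n) m _ (λ l → h0 (0 ∷ l)))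
           (sum-cong-≗ {m} (λ v → ∑ⱽ-split-zero n m _ (λ l → h0 (suc (toℕ v) ∷ l)))) ⟩
    a + sum {m} (λ v → b v + sum {suc n} (c v))
      ≡⟨ cong (a +_) (∑-distrib-+ {m} b (λ v → sum {suc n} (c v))) ⟩
    a + (sum {m} b + sum {m} (λ v → sum {suc n} (c v)))
      ≡⟨ cong (λ x → a + (sum {m} b + x)) (∑-comm {m} {suc n} c) ⟩
    a + (sum {m} b + sum {suc n} (λ i → sum {m} (λ v → c v i)))
      ≡⟨ x+[y+z]≡y+[x+z] a (sum {m} b) _ ⟩
    sum {m} b + (a + sum {suc n} (λ i → sum {m} (λ v → c v i))) ∎
    where
    open ≡-Reasoning
    a = ∑ⱽ (suc n) m (λ l → h (0 ∷ Vec.map suc l))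
    b : Fin m → ℕ
    b v = ∑ⱽ (suc n) m (λ l → h (suc (toℕ v) ∷ Vec.map suc l))
    c : Fin m → Fin (suc n) → ℕ
    c v i = ∑ⱽ n m (λ l → h (suc (toℕ v) ∷ insertAt (Vec.map suc l) i 0))

  distinct : ∀ {n} → Vec ℕ n → Bool
  distinct []      = true
  distinct (x ∷ l) = not (mem x l) ∧ distinct l

  repeats-zero⇒¬distinct : ∀ {n} (l : Vec ℕ n) → repeats-zero l ≡ true → distinct l ≡ false
  repeats-zero⇒¬distinct (zero  ∷ l) 0∈l rewrite 0∈l = refl
  repeats-zero⇒¬distinct (suc x ∷ l) r rewrite repeats-zero⇒¬distinct l r = ∧-zeroʳ _

  mem-map-suc : ∀ {n} v (l : Vec ℕ n) → mem (suc v) (Vec.map suc l) ≡ mem v l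
  mem-map-suc v []      = refl
  mem-map-suc v (x ∷ l) = cong ((v ≡ᵇ x) ∨_) (mem-map-suc v l)

  mem-zero-map-suc : ∀ {n} (l : Vec ℕ n) → mem 0 (Vec.map suc l) ≡ false
  mem-zero-map-suc []      = refl
  mem-zero-map-suc (x ∷ l) = mem-zero-map-suc l

  mem-insertAt-zero : ∀ {n} v (l : Vec ℕ n) i → mem (suc v) (insertAt l i 0) ≡ mem (suc v) l
  mem-insertAt-zero v l       zero    = refl
  mem-insertAt-zero v (x ∷ l) (suc i) = cong ((suc v ≡ᵇ x) ∨_) (mem-insertAt-zero v l i)

  distinct-map-suc : ∀ {n} (l : Vec ℕ n) → distinct (Vec.map suc l) ≡ distinct l
  distinct-map-suc []      = refl
  distinct-map-suc (x ∷ l) = cong₂ (λ a b → not a ∧ b) (mem-map-suc x l) (distinct-map-suc l)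

  distinct-insertAt-zero : ∀ {n} (l : Vec ℕ n) i → distinct (insertAt (Vec.map suc l) i 0) ≡ distinct l
  distinct-insertAt-zero l       zero    = cong₂ (λ a b → not a ∧ b) (mem-zero-map-suc l) (distinct-map-suc l)
  distinct-insertAt-zero (x ∷ l) (suc i) = cong₂ (λ a b → not a ∧ b)
    (trans (mem-insertAt-zero x (Vec.map suc l) i) (mem-map-suc x l)) (distinct-insertAt-zero l i)

  ∑ᴵ : (n m : ℕ) → (Vec ℕ n → ℕ) → ℕ
  ∑ᴵ n m h = ∑ⱽ n m (λ l → indicator (distinct l) * h l)

  ∑ᴵ-cong : (n m : ℕ) {h h′ : Vec ℕ n → ℕ} → h ≗ h′ → ∑ᴵ n m h ≡ ∑ᴵ n m h′
  ∑ᴵ-cong n m h≗h′ = ∑ⱽ-cong n m (λ l → cong (indicator (distinct l) *_) (h≗h′ l))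

  ∑ᴵ-*ˡ : (n m c : ℕ) (h : Vec ℕ n → ℕ) → ∑ᴵ n m (λ l → c * h l) ≡ c * ∑ᴵ n m h
  ∑ᴵ-*ˡ n m c h = trans (∑ⱽ-cong n m (λ l → x*[y*z]≡y*[x*z] (indicator (distinct l)) c (h l)))
                        (∑ⱽ-*ˡ n m c (λ l → indicator (distinct l) * h l))

  -- Conditions on the holder of rank 0: either nobody holds it, or server `i` does and the others
  -- inject into the remaining `m` ranks. The first case is why the number of ranks is kept separate
  -- from the number of servers.
  ∑ᴵ-split-zero : (n m : ℕ) (h : Vec ℕ (suc n) → ℕ) →
    ∑ᴵ (suc n) (suc m) h ≡
    ∑ᴵ (suc n) m (h ∘ Vec.map suc) + sum {suc n} (λ i → ∑ᴵ n m (λ l → h (insertAt (Vec.map suc l) i 0)))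
  ∑ᴵ-split-zero n m h = trans
    (∑ⱽ-split-zero n m _ (λ l r → cong (λ b → indicator b * h l) (repeats-zero⇒¬distinct l r)))
    (cong₂ _+_
      (∑ⱽ-cong (suc n) m (λ l → cong (λ b → indicator b * h (Vec.map suc l)) (distinct-map-suc l)))
      (sum-cong-≗ {suc n} (λ i → ∑ⱽ-cong n m (λ l →
        cong (λ b → indicator b * h (insertAt (Vec.map suc l) i 0)) (distinct-insertAt-zero l i)))))

  -- Targets left unmatched

  -- The i-th companion in index order is the private server of the i-th request; inert servers
  -- stand for companions whose request has already been assigned to a target.
  data Role : Set where
    target companion inert : Role

  isTarget isCompanion : Role → ℕ
  isTarget target = 1
  isTarget _ = 0
  isCompanion companion = 1
  isCompanion _ = 0

  count : ∀ {n} → (Role → ℕ) → Vec Role n → ℕ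
  count w []       = 0
  count w (r ∷ rs) = w r + count w rs

  count-removeAt : ∀ {n} w (rs : Vec Role (suc n)) i →
    count w rs ≡ w (lookup rs i) + count w (removeAt rs i)
  count-removeAt w (r ∷ rs)         zero    = refl
  count-removeAt w (r ∷ rs@(_ ∷ _)) (suc i) =
    trans (cong (w r +_) (count-removeAt w rs i)) (x+[y+z]≡y+[x+z] (w r) (w (lookup rs i)) _)

  ∑-lookup : ∀ {n} w (rs : Vec Role n) → sum {n} (λ i → w (lookup rs i)) ≡ count w rs
  ∑-lookup w []       = refl
  ∑-lookup w (r ∷ rs) = cong (w r +_) (∑-lookup w rs)

  insert : ℕ → List ℕ → List ℕ
  insert v []       = v ∷ []
  insert v (x ∷ xs) = if x <ᵇ v then x ∷ insert v xs else v ∷ x ∷ xs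

  targets : ∀ {n} → Vec Role n → Vec ℕ n → List ℕ
  targets []                l       = []
  targets (target    ∷ rs) (v ∷ l) = insert v (targets rs l)
  targets (companion ∷ rs) (v ∷ l) = targets rs l
  targets (inert     ∷ rs) (v ∷ l) = targets rs l

  companions : ∀ {n} → Vec Role n → Vec ℕ n → List ℕ
  companions []                l       = []
  companions (target    ∷ rs) (v ∷ l) = companions rs l
  companions (companion ∷ rs) (v ∷ l) = v ∷ companions rs l
  companions (inert     ∷ rs) (v ∷ l) = companions rs l

  -- The number of targets left by Ranking, given the sorted ranks of the targets and, in arrival
  -- order, the ranks of the companions of the requests.
  survivors : List ℕ → List ℕ → ℕ
  survivors ts       []       = List.length ts
  survivors []       (x ∷ xs) = 0
  survivors (t ∷ ts) (x ∷ xs) = if t <ᵇ x then survivors ts xs else survivors (t ∷ ts) xs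

  -- Ranks enter only through comparisons, which `suc` preserves.
  survivors-map-suc : ∀ ts xs → survivors (List.map suc ts) (List.map suc xs) ≡ survivors ts xs
  survivors-map-suc ts       []       = length-map suc ts
  survivors-map-suc []       (x ∷ xs) = refl
  survivors-map-suc (t ∷ ts) (x ∷ xs) with t <ᵇ x
  ... | true  = survivors-map-suc ts xs
  ... | false = survivors-map-suc (t ∷ ts) xs

  -- A companion of rank 0 keeps its request from every target, so it can be dropped.
  positives : List ℕ → List ℕ
  positives []           = []
  positives (zero  ∷ xs) = positives xs
  positives (suc x ∷ xs) = suc x ∷ positives xs

  positives-map-suc : ∀ xs → positives (List.map suc xs) ≡ List.map suc xs
  positives-map-suc []       = refl
  positives-map-suc (x ∷ xs) = cong (suc x ∷_) (positives-map-suc xs)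

  survivors-[] : ∀ xs → survivors [] xs ≡ 0
  survivors-[] []       = refl
  survivors-[] (x ∷ xs) = refl

  survivors-positives : ∀ ts xs → survivors ts (positives xs) ≡ survivors ts xs
  survivors-positives ts       []           = refl
  survivors-positives []       (zero  ∷ xs) = survivors-[] (positives xs)
  survivors-positives []       (suc x ∷ xs) = refl
  survivors-positives (t ∷ ts) (zero  ∷ xs) = survivors-positives (t ∷ ts) xs
  survivors-positives (t ∷ ts) (suc x ∷ xs) with t <ᵇ suc x
  ... | true  = survivors-positives ts xs
  ... | false = survivors-positives (t ∷ ts) xs

  insert-map-suc : ∀ v xs → insert (suc v) (List.map suc xs) ≡ List.map suc (insert v xs)
  insert-map-suc v []       = refl
  insert-map-suc v (x ∷ xs) with x <ᵇ v
  ... | true  = cong (suc x ∷_) (insert-map-suc v xs)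
  ... | false = refl

  insert-zero : ∀ xs → insert 0 xs ≡ 0 ∷ xs
  insert-zero []       = refl
  insert-zero (x ∷ xs) = refl

  length-insert : ∀ v xs → List.length (insert v xs) ≡ suc (List.length xs)
  length-insert v []       = refl
  length-insert v (x ∷ xs) with x <ᵇ v
  ... | true  = cong suc (length-insert v xs)
  ... | false = refl

  targets-map-suc : ∀ {n} (rs : Vec Role n) l →
    targets rs (Vec.map suc l) ≡ List.map suc (targets rs l)
  targets-map-suc []               l       = refl
  targets-map-suc (target    ∷ rs) (v ∷ l) =
    trans (cong (insert (suc v)) (targets-map-suc rs l)) (insert-map-suc v (targets rs l))
  targets-map-suc (companion ∷ rs) (v ∷ l) = targets-map-suc rs l
  targets-map-suc (inert     ∷ rs) (v ∷ l) = targets-map-suc rs l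

  companions-map-suc : ∀ {n} (rs : Vec Role n) l →
    companions rs (Vec.map suc l) ≡ List.map suc (companions rs l)
  companions-map-suc []               l       = refl
  companions-map-suc (target    ∷ rs) (v ∷ l) = companions-map-suc rs l
  companions-map-suc (companion ∷ rs) (v ∷ l) = cong (suc v ∷_) (companions-map-suc rs l)
  companions-map-suc (inert     ∷ rs) (v ∷ l) = companions-map-suc rs l

  length-targets : ∀ {n} (rs : Vec Role n) l → List.length (targets rs l) ≡ count isTarget rs
  length-targets []               l       = refl
  length-targets (target    ∷ rs) (v ∷ l) =
    trans (length-insert v (targets rs l)) (cong suc (length-targets rs l))
  length-targets (companion ∷ rs) (v ∷ l) = length-targets rs l
  length-targets (inert     ∷ rs) (v ∷ l) = length-targets rs l

  no-companions : ∀ {n} (rs : Vec Role n) l → count isCompanion rs ≡ 0 → companions rs l ≡ []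
  no-companions []               l       none = refl
  no-companions (target    ∷ rs) (v ∷ l) none = no-companions rs l none
  no-companions (inert     ∷ rs) (v ∷ l) none = no-companions rs l none

  -- The effect of rank 0 on the sorted target ranks: a target contributes a new least element, any
  -- other role contributes nothing.
  prependZero : Role → List ℕ → List ℕ
  prependZero target xs = 0 ∷ xs
  prependZero _      xs = xs

  insert-prependZero : ∀ r v xs → insert (suc v) (prependZero r (List.map suc xs))
    ≡ prependZero r (List.map suc (insert v xs))
  insert-prependZero target    v xs = cong (0 ∷_) (insert-map-suc v xs)
  insert-prependZero companion v xs = insert-map-suc v xs
  insert-prependZero inert     v xs = insert-map-suc v xs

  targets-insertAt-zero : ∀ {n} (rs : Vec Role (suc n)) (l : Vec ℕ n) i →
    targets rs (insertAt (Vec.map suc l) i 0) ≡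
    prependZero (lookup rs i) (List.map suc (targets (removeAt rs i) l))
  targets-insertAt-zero (target    ∷ rs) l zero =
    trans (insert-zero _) (cong (0 ∷_) (targets-map-suc rs l))
  targets-insertAt-zero (companion ∷ rs) l zero = targets-map-suc rs l
  targets-insertAt-zero (inert     ∷ rs) l zero = targets-map-suc rs l
  targets-insertAt-zero (target    ∷ rs@(_ ∷ _)) (v ∷ l) (suc i) =
    trans (cong (insert (suc v)) (targets-insertAt-zero rs l i))
          (insert-prependZero (lookup rs i) v (targets (removeAt rs i) l))
  targets-insertAt-zero (companion ∷ rs@(_ ∷ _)) (v ∷ l) (suc i) = targets-insertAt-zero rs l i
  targets-insertAt-zero (inert     ∷ rs@(_ ∷ _)) (v ∷ l) (suc i) = targets-insertAt-zero rs l i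

  positives-companions-map-suc : ∀ {n} (rs : Vec Role n) l →
    positives (companions rs (Vec.map suc l)) ≡ List.map suc (companions rs l)
  positives-companions-map-suc rs l = trans (cong positives (companions-map-suc rs l)) (positives-map-suc (companions rs l))

  -- Applying `positives` hides whether the server of rank 0 was a companion, so all three roles
  -- share one formula.
  positives-companions : ∀ {n} (rs : Vec Role (suc n)) (l : Vec ℕ n) i →
    positives (companions rs (insertAt (Vec.map suc l) i 0)) ≡ List.map suc (companions (removeAt rs i) l)
  positives-companions (target    ∷ rs) l zero = positives-companions-map-suc rs l
  positives-companions (companion ∷ rs) l zero = positives-companions-map-suc rs l
  positives-companions (inert     ∷ rs) l zero = positives-companions-map-suc rs l
  positives-companions (target    ∷ rs@(_ ∷ _)) (v ∷ l) (suc i) = positives-companions rs l i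
  positives-companions (companion ∷ rs@(_ ∷ _)) (v ∷ l) (suc i) = cong (suc v ∷_) (positives-companions rs l i)
  positives-companions (inert     ∷ rs@(_ ∷ _)) (v ∷ l) (suc i) = positives-companions rs l i

  -- The first companion in index order belongs to the next request. Once a target has taken that
  -- request, the companion still holds a rank but competes for nothing; turning it inert keeps the
  -- number of servers unchanged.
  retire : ∀ {n} → Vec Role n → Vec Role n
  retire []               = []
  retire (companion ∷ rs) = inert ∷ rs
  retire (r         ∷ rs) = r ∷ retire rs

  count-target-retire : ∀ {n} (rs : Vec Role n) → count isTarget (retire rs) ≡ count isTarget rs
  count-target-retire []               = refl
  count-target-retire (target    ∷ rs) = cong suc (count-target-retire rs)
  count-target-retire (companion ∷ rs) = refl
  count-target-retire (inert     ∷ rs) = count-target-retire rs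

  count-companion-retire : ∀ {n} (rs : Vec Role n) →
    count isCompanion (retire rs) ≡ pred (count isCompanion rs)
  count-companion-retire []               = refl
  count-companion-retire (target    ∷ rs) = count-companion-retire rs
  count-companion-retire (companion ∷ rs) = refl
  count-companion-retire (inert     ∷ rs) = count-companion-retire rs

  targets-retire : ∀ {n} (rs : Vec Role n) l → targets (retire rs) l ≡ targets rs l
  targets-retire []               l       = refl
  targets-retire (target    ∷ rs) (v ∷ l) = cong (insert v) (targets-retire rs l)
  targets-retire (companion ∷ rs) (v ∷ l) = refl
  targets-retire (inert     ∷ rs) (v ∷ l) = targets-retire rs l

  companions-retire : ∀ {n k} (rs : Vec Role n) l → count isCompanion rs ≡ suc k →
    Σ ℕ λ x → companions rs l ≡ x ∷ companions (retire rs) l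
  companions-retire (target    ∷ rs) (v ∷ l) eq = companions-retire rs l eq
  companions-retire (companion ∷ rs) (v ∷ l) eq = v , refl
  companions-retire (inert     ∷ rs) (v ∷ l) eq = companions-retire rs l eq

  unmatched : ∀ {n} → Vec Role n → Vec ℕ n → ℕ
  unmatched rs l = survivors (targets rs l) (companions rs l)

  unmatched-map-suc : ∀ {n} (rs : Vec Role n) l → unmatched rs (Vec.map suc l) ≡ unmatched rs l
  unmatched-map-suc rs l = trans (cong₂ survivors (targets-map-suc rs l) (companions-map-suc rs l))
                                 (survivors-map-suc (targets rs l) (companions rs l))

  unmatched-no-companions : ∀ {n} (rs : Vec Role n) l → count isCompanion rs ≡ 0 →
    unmatched rs l ≡ count isTarget rs
  unmatched-no-companions rs l none =
    trans (cong (survivors (targets rs l)) (no-companions rs l none)) (length-targets rs l)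

  unmatched-insertAt-zero : ∀ {n} (rs : Vec Role (suc n)) (l : Vec ℕ n) i →
    unmatched rs (insertAt (Vec.map suc l) i 0) ≡
    survivors (prependZero (lookup rs i) (List.map suc (targets (removeAt rs i) l)))
              (List.map suc (companions (removeAt rs i) l))
  unmatched-insertAt-zero rs l i = trans (sym (survivors-positives _ (companions rs (insertAt (Vec.map suc l) i 0))))
    (cong₂ survivors (targets-insertAt-zero rs l i) (positives-companions rs l i))

  -- A companion of rank 0 wins its own request and an inert server wins none, so deleting either
  -- leaves the fate of the targets as it was.
  unmatched-insertAt-zero-other : ∀ {n} (rs : Vec Role (suc n)) (l : Vec ℕ n) i →
    isTarget (lookup rs i) ≡ 0 → unmatched rs (insertAt (Vec.map suc l) i 0) ≡ unmatched (removeAt rs i) l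
  unmatched-insertAt-zero-other rs l i eq with lookup rs i | unmatched-insertAt-zero rs l i
  ... | companion | u = trans u (survivors-map-suc (targets (removeAt rs i) l) (companions (removeAt rs i) l))
  ... | inert     | u = trans u (survivors-map-suc (targets (removeAt rs i) l) (companions (removeAt rs i) l))

  -- The target of rank 0 takes the first request.
  unmatched-insertAt-zero-target : ∀ {n k} (rs : Vec Role (suc n)) (l : Vec ℕ n) i →
    lookup rs i ≡ target → count isCompanion (removeAt rs i) ≡ suc k →
    unmatched rs (insertAt (Vec.map suc l) i 0) ≡ unmatched (retire (removeAt rs i)) l
  unmatched-insertAt-zero-target rs l i eq some
    with x , first ← companions-retire (removeAt rs i) l some
    with u ← unmatched-insertAt-zero rs l i
    -- The first companion now has rank `suc x`, so `0 <ᵇ suc x` computes to `true` whatever `x` is,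
    -- and the leading target disappears.
    rewrite eq | first = trans u (trans (survivors-map-suc (targets (removeAt rs i) l) (companions (retire (removeAt rs i)) l))
        (cong (λ ts → survivors ts (companions (retire (removeAt rs i)) l)) (sym (targets-retire (removeAt rs i) l))))

  -- The lower bound

  injections : ℕ → ℕ → ℕ
  injections n m = ∑ᴵ n m (λ _ → 1)

  ^-distribʳ-* : ∀ k m n → (m * n) ^ k ≡ m ^ k * n ^ k
  ^-distribʳ-* zero    m n = refl
  ^-distribʳ-* (suc k) m n = trans (cong (m * n *_) (^-distribʳ-* k m n)) (*-interchange m n (m ^ k) (n ^ k))

  -- Bernoulli's inequality (1 - 1/(1+a))^(k+1) ≥ 1 - (k+1)/(1+a), multiplied by (1+a)^(k+1) and
  -- arranged without subtraction.
  bernoulli : ∀ a k → suc a ^ suc k ≤ a ^ suc k + suc k * suc a ^ k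
  bernoulli a zero    = ≤-reflexive (+-comm 1 (a * 1))
  bernoulli a (suc k) = begin
    suc a * suc a ^ suc k                               ≤⟨ *-monoʳ-≤ (suc a) (bernoulli a k) ⟩
    suc a * (a ^ suc k + suc k * suc a ^ k)             ≡⟨ expand a (a ^ suc k) k (suc a ^ k) ⟩
    a ^ suc (suc k) + (a ^ suc k + suc k * suc a ^ suc k)
      ≤⟨ +-monoʳ-≤ (a ^ suc (suc k)) (+-monoˡ-≤ _ (^-monoˡ-≤ (suc k) (n≤1+n a))) ⟩
    a ^ suc (suc k) + suc (suc k) * suc a ^ suc k       ∎
    where
    open ≤-Reasoning
    expand : ∀ a x k y → suc a * (x + suc k * y) ≡ a * x + (x + suc k * (suc a * y))
    expand = solve-∀

  -- (1 − 1/N²)ᵏ ≥ 1 − k/N² with N = 1+n and k = 1+j, cleared of denominators.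
  bernoulli-square : ∀ n j →
    suc n ^ j * suc n ^ suc (suc j) ≤ n ^ suc j * suc (suc n) ^ suc j + suc j * (suc n ^ j * suc n ^ j)
  bernoulli-square n j = begin
    suc n ^ j * suc n ^ suc (suc j)            ≡⟨ regroup (suc n) (suc n ^ j) ⟩
    suc n ^ suc j * suc n ^ suc j              ≡⟨ ^-distribʳ-* (suc j) (suc n) (suc n) ⟨
    -- N² - 1 factors as (N - 1)(N + 1), so Bernoulli's inequality is used with a = n(n + 2), whose
    -- powers split again.
    (suc n * suc n) ^ suc j                    ≡⟨ cong (_^ suc j) square ⟩
    suc (n * suc (suc n)) ^ suc j              ≤⟨ bernoulli (n * suc (suc n)) j ⟩
    (n * suc (suc n)) ^ suc j + suc j * suc (n * suc (suc n)) ^ j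
      ≡⟨ cong₂ (λ x y → x + suc j * y) (^-distribʳ-* (suc j) n (suc (suc n)))
           (trans (cong (_^ j) (sym square)) (^-distribʳ-* j (suc n) (suc n))) ⟩
    n ^ suc j * suc (suc n) ^ suc j + suc j * (suc n ^ j * suc n ^ j) ∎
    where
    open ≤-Reasoning
    square : suc n * suc n ≡ suc (n * suc (suc n))
    square = cong suc (sym (*-suc n (suc n)))
    regroup : ∀ x y → y * (x * (x * y)) ≡ (x * y) * (x * y)
    regroup = solve-∀

  -- The case of a target at rank 0. The bound for (N-1, k-1) may fall short of the one for (N, k),
  -- but by `bernoulli-square` the deficit is at most k N^(k-1) per injection. Multiplying through
  -- by N^(k-1) lets the hypothesis be inserted.
  target-step : ∀ n j c x → n ^ suc j * c ≤ suc n ^ j * x →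
    suc n ^ suc (suc j) * c ≤ suc (suc n) ^ suc j * x + suc j * suc n ^ j * c
  target-step n j c x hyp = *-cancelˡ-≤ (suc n ^ j) {{m^n≢0 (suc n) j}} (begin
    N ^ j * (N ^ suc (suc j) * c)                              ≡⟨ *-assoc (N ^ j) _ c ⟨
    N ^ j * N ^ suc (suc j) * c                                ≤⟨ *-monoˡ-≤ c (bernoulli-square n j) ⟩
    (n ^ suc j * D + suc j * (N ^ j * N ^ j)) * c              ≡⟨ eq₁ (n ^ suc j) D (suc j) (N ^ j) c ⟩
    D * (n ^ suc j * c) + N ^ j * (suc j * N ^ j * c)          ≤⟨ +-monoˡ-≤ _ (*-monoʳ-≤ D hyp) ⟩
    D * (N ^ j * x) + N ^ j * (suc j * N ^ j * c)              ≡⟨ eq₂ D (N ^ j) x (suc j * N ^ j * c) ⟩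
    N ^ j * (D * x + suc j * N ^ j * c)                        ∎)
    where
    open ≤-Reasoning
    N = suc n
    D = suc N ^ suc j
    eq₁ : ∀ p q r s c → (p * q + r * (s * s)) * c ≡ q * (p * c) + s * (r * s * c)
    eq₁ = solve-∀
    eq₂ : ∀ p q x y → p * (q * x) + q * y ≡ q * (p * x + y)
    eq₂ = solve-∀

  -- The case of a companion at rank 0. One companion fewer improves the bound by the factor
  -- (N+1)/N, and the resulting surplus pays for the deficits of the target terms.
  companion-step : ∀ N j c x → N ^ suc j * c ≤ suc N ^ j * x →
    N ^ suc (suc j) * c + N ^ suc j * c ≤ suc N ^ suc j * x
  companion-step N j c x hyp = begin
    N * N ^ suc j * c + N ^ suc j * c  ≡⟨ eq N (N ^ suc j) c ⟩
    suc N * (N ^ suc j * c)            ≤⟨ *-monoʳ-≤ (suc N) hyp ⟩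
    suc N * (suc N ^ j * x)            ≡⟨ *-assoc (suc N) (suc N ^ j) x ⟨
    suc N ^ suc j * x                  ∎
    where
    open ≤-Reasoning
    eq : ∀ N p c → N * p * c + p * c ≡ suc N * (p * c)
    eq = solve-∀

  ∑-weight : ∀ {n} z w (rs : Vec Role n) → sum {n} (λ i → z * w (lookup rs i)) ≡ z * count w rs
  ∑-weight z w rs = trans (∑-*ˡ _ z (w ∘ lookup rs)) (cong (z *_) (∑-lookup w rs))

  -- The estimate f(N,k) ≥ N (N/(N+1))ᵏ, cleared of denominators. The induction is on the number of
  -- ranks `m`, which drops whether or not rank 0 is held. Inert servers enter neither count, so the
  -- bound is uniform in their number.
  ∑ᴵ-unmatched : ∀ m {n} (rs : Vec Role n) N k → count isTarget rs ≡ N → count isCompanion rs ≡ k →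
    N ^ suc k * injections n m ≤ suc N ^ k * ∑ᴵ n m (unmatched rs)
  ∑ᴵ-unmatched m rs zero k #t #c = z≤n
  ∑ᴵ-unmatched m {n} rs N@(suc _) zero #t #c = ≤-reflexive (begin
    N ^ 1 * injections n m                ≡⟨ cong (_* injections n m) (*-identityʳ N) ⟩
    N * injections n m                    ≡⟨ ∑ᴵ-*ˡ n m N (λ _ → 1) ⟨
    ∑ᴵ n m (λ _ → N * 1)                  ≡⟨ ∑ᴵ-cong n m (λ l → trans (*-identityʳ N)
                                               (sym (trans (unmatched-no-companions rs l #c) #t))) ⟩
    ∑ᴵ n m (unmatched rs)                 ≡⟨ *-identityˡ _ ⟨
    1 * ∑ᴵ n m (unmatched rs)             ∎)
    where open ≡-Reasoning
  ∑ᴵ-unmatched m [] (suc _) (suc _) () #c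
  -- A nonempty set of servers has no injection into zero ranks, so both sums compute to 0.
  ∑ᴵ-unmatched zero {suc n} rs N@(suc _) k@(suc _) #t #c =
    subst (_≤ suc N ^ k * 0) (sym (*-zeroʳ (N ^ suc k))) z≤n
  ∑ᴵ-unmatched (suc m) {suc n} rs N@(suc N′) k@(suc k′) #t #c = begin
    P * injections (suc n) (suc m)
      ≡⟨ cong (P *_) (∑ᴵ-split-zero n m (λ _ → 1)) ⟩
    P * (injections (suc n) m + sum {suc n} (λ _ → c))
      ≡⟨ *-distribˡ-+ P (injections (suc n) m) _ ⟩
    P * injections (suc n) m + P * sum {suc n} (λ _ → c)
      ≤⟨ +-mono-≤ (∑ᴵ-unmatched m rs N k #t #c) total ⟩
    D * ∑ᴵ (suc n) m (unmatched rs) + D * sum X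
      ≡⟨ *-distribˡ-+ D (∑ᴵ (suc n) m (unmatched rs)) (sum X) ⟨
    D * (∑ᴵ (suc n) m (unmatched rs) + sum X)
      ≡⟨ cong (λ x → D * (x + sum X)) (∑ᴵ-cong (suc n) m (λ l → sym (unmatched-map-suc rs l))) ⟩
    D * (∑ᴵ (suc n) m (unmatched rs ∘ Vec.map suc) + sum X)
      ≡⟨ cong (D *_) (∑ᴵ-split-zero n m (unmatched rs)) ⟨
    D * ∑ᴵ (suc n) (suc m) (unmatched rs) ∎
    where
    open ≤-Reasoning
    P = N ^ suc k
    D = suc N ^ k
    c = injections n m
    -- `gain` is the surplus of each companion term and `loss` the largest deficit of a target term;
    -- inert terms have neither.
    gain = N ^ k * c
    loss = k * N ^ k′ * c
    X : Fin (suc n) → ℕ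
    X i = ∑ᴵ n m (λ l → unmatched rs (insertAt (Vec.map suc l) i 0))

    targets-left : ∀ {r} i → lookup rs i ≡ r → N ≡ isTarget r + count isTarget (removeAt rs i)
    targets-left i refl = trans (sym #t) (count-removeAt isTarget rs i)

    companions-left : ∀ {r} i → lookup rs i ≡ r → k ≡ isCompanion r + count isCompanion (removeAt rs i)
    companions-left i refl = trans (sym #c) (count-removeAt isCompanion rs i)

    term : ∀ i → P * c + gain * isCompanion (lookup rs i) ≤ D * X i + loss * isTarget (lookup rs i)
    term i with lookup rs i in eq
    ... | inert = +-mono-≤
      (subst (λ x → P * c ≤ D * x)
        (∑ᴵ-cong n m (λ l → sym (unmatched-insertAt-zero-other rs l i (cong isTarget eq))))
        (∑ᴵ-unmatched m (removeAt rs i) N k (sym (targets-left i eq)) (sym (companions-left i eq))))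
      (≤-trans (≤-reflexive (*-zeroʳ gain)) z≤n)
    ... | companion = begin
      P * c + gain * 1          ≡⟨ cong (P * c +_) (*-identityʳ gain) ⟩
      P * c + gain              ≤⟨ companion-step N k′ c (X i) (subst (λ x → N ^ k * c ≤ suc N ^ k′ * x)
        (∑ᴵ-cong n m (λ l → sym (unmatched-insertAt-zero-other rs l i (cong isTarget eq))))
        (∑ᴵ-unmatched m (removeAt rs i) N k′ (sym (targets-left i eq)) (suc-injective (sym (companions-left i eq))))) ⟩
      D * X i                   ≤⟨ m≤m+n (D * X i) (loss * 0) ⟩
      D * X i + loss * 0        ∎
    ... | target = begin
      P * c + gain * 0          ≡⟨ cong (P * c +_) (*-zeroʳ gain) ⟩
      P * c + 0                 ≡⟨ +-identityʳ _ ⟩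
      P * c                     ≤⟨ target-step N′ k′ c (X i) (subst (λ x → N′ ^ k * c ≤ N ^ k′ * x)
        (∑ᴵ-cong n m (λ l → sym (unmatched-insertAt-zero-target rs l i eq (sym (companions-left i eq)))))
        (∑ᴵ-unmatched m (retire (removeAt rs i)) N′ k′
          (trans (count-target-retire (removeAt rs i)) (suc-injective (sym (targets-left i eq))))
          (trans (count-companion-retire (removeAt rs i)) (cong pred (sym (companions-left i eq)))))) ⟩
      D * X i + loss            ≡⟨ cong (D * X i +_) (*-identityʳ loss) ⟨
      D * X i + loss * 1        ∎

    -- The `k` surpluses and the `N` deficits both add up to k Nᵏ c, so they cancel in the total.
    balance : ∀ N k y c → k * y * c * N ≡ N * y * c * k
    balance = solve-∀

    total : P * sum {suc n} (λ _ → c) ≤ D * sum X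
    total = +-cancelʳ-≤ (gain * k) _ _ (begin
      P * sum {suc n} (λ _ → c) + gain * k
        ≡⟨ cong₂ _+_ (∑-*ˡ (suc n) P (λ _ → c)) (trans (∑-weight gain isCompanion rs) (cong (gain *_) #c)) ⟨
      sum {suc n} (λ _ → P * c) + sum (λ i → gain * isCompanion (lookup rs i))
        ≡⟨ ∑-distrib-+ {suc n} (λ _ → P * c) (λ i → gain * isCompanion (lookup rs i)) ⟨
      sum (λ i → P * c + gain * isCompanion (lookup rs i))
        ≤⟨ ∑-mono-≤ (suc n) term ⟩
      sum (λ i → D * X i + loss * isTarget (lookup rs i))
        ≡⟨ ∑-distrib-+ {suc n} (λ i → D * X i) (λ i → loss * isTarget (lookup rs i)) ⟩
      sum (λ i → D * X i) + sum (λ i → loss * isTarget (lookup rs i))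
        ≡⟨ cong₂ _+_ (∑-*ˡ (suc n) D X) (trans (∑-weight loss isTarget rs) (cong (loss *_) #t)) ⟩
      D * sum X + loss * N
        ≡⟨ cong (D * sum X +_) (balance N k (N ^ k′) c) ⟩
      D * sum X + gain * k ∎)

  -- Keeps the denominator of the expectation nonzero. The injections that give rank 0 to the first
  -- server already suffice.
  injections-positive : ∀ n → 1 ≤ injections n n
  injections-positive zero    = s≤s z≤n
  injections-positive (suc n) = begin
    1                                                     ≤⟨ injections-positive n ⟩
    injections n n                                        ≤⟨ m≤m+n (injections n n) (sum {n} (λ _ → injections n n)) ⟩
    sum {suc n} (λ _ → injections n n)                    ≤⟨ m≤n+m _ (injections (suc n) n) ⟩
    injections (suc n) n + sum {suc n} (λ _ → injections n n) ≡⟨ ∑ᴵ-split-zero n n (λ _ → 1) ⟨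
    injections (suc n) (suc n) ∎
    where open ≤-Reasoning

  -- The Ranking algorithm

  ∧-true : ∀ {a b} → a ∧ b ≡ true → a ≡ true × b ≡ true
  ∧-true {true} {true} refl = refl , refl

  ∧-intro : ∀ {a b} → a ≡ true → b ≡ true → a ∧ b ≡ true
  ∧-intro refl refl = refl

  not-true : ∀ {b} → not b ≡ true → b ≡ false
  not-true {false} refl = refl

  true≢false : ∀ {b} → b ≡ true → b ≢ false
  true≢false refl ()

  ≟-refl : (i : Fin n) → ⌊ i ≟ i ⌋ ≡ true
  ≟-refl i with i ≟ i
  ... | yes _  = refl
  ... | no i≢i = contradiction refl i≢i

  ≢⇒≟-false : {i j : Fin n} → i ≢ j → ⌊ i ≟ j ⌋ ≡ false
  ≢⇒≟-false {i = i} {j} i≢j with i ≟ j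
  ... | yes i≡j = contradiction i≡j i≢j
  ... | no  _   = refl

  ≟-true⇒≡ : {i j : Fin n} → ⌊ i ≟ j ⌋ ≡ true → i ≡ j
  ≟-true⇒≡ {i = i} {j} eq with yes i≡j ← i ≟ j = i≡j

  suc-≟ : (i j : Fin n) → ⌊ suc i ≟ suc j ⌋ ≡ ⌊ i ≟ j ⌋
  suc-≟ i j with i ≟ j
  ... | yes _ = refl
  ... | no  _ = refl

  -- Counting by injections

  countTrue-cong : ∀ {n} {p q : Fin n → Bool} → p ≗ q → countTrue p ≡ countTrue q
  countTrue-cong {zero}  p≗q = refl
  countTrue-cong {suc n} p≗q = cong₂ (λ b c → (if b then 1 else 0) + c) (p≗q zero) (countTrue-cong (p≗q ∘ suc))

  countTrue-remove : ∀ {n} (p : Fin n → Bool) s → p s ≡ true →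
    countTrue p ≡ suc (countTrue (λ t → p t ∧ not ⌊ t ≟ s ⌋))
  countTrue-remove {suc n} p zero ps rewrite ps =
    cong suc (countTrue-cong (λ t → sym (∧-identityʳ (p (suc t)))))
  countTrue-remove {suc n} p (suc s) ps = begin
    x + countTrue (p ∘ suc)                                      ≡⟨ cong (x +_) (countTrue-remove (p ∘ suc) s ps) ⟩
    x + suc (countTrue (λ t → p (suc t) ∧ not ⌊ t ≟ s ⌋))         ≡⟨ +-suc x _ ⟩
    suc (x + countTrue (λ t → p (suc t) ∧ not ⌊ t ≟ s ⌋))
      ≡⟨ cong suc (cong₂ (λ b c → (if b then 1 else 0) + c) (sym (∧-identityʳ (p zero)))
           (countTrue-cong (λ t → cong (λ b → p (suc t) ∧ not b) (sym (suc-≟ t s))))) ⟩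
    suc (countTrue (λ t → p t ∧ not ⌊ t ≟ suc s ⌋)) ∎
    where
    open ≡-Reasoning
    x = if p zero then 1 else 0

  -- The value `g zero` is struck from `p`, and by injectivity the rest of `g` lands in what
  -- remains.
  injection⇒≤countTrue : ∀ {a b} (p : Fin b → Bool) (g : Fin a → Fin b) →
    (∀ {i j} → g i ≡ g j → i ≡ j) → (∀ i → p (g i) ≡ true) → a ≤ countTrue p
  injection⇒≤countTrue {zero}  p g g-inj pg = z≤n
  injection⇒≤countTrue {suc a} p g g-inj pg = subst (suc a ≤_) (sym (countTrue-remove p (g zero) (pg zero)))
    (s≤s (injection⇒≤countTrue (λ t → p t ∧ not ⌊ t ≟ g zero ⌋) (g ∘ suc) (sucF-injective ∘ g-inj)
      (λ i → ∧-intro (pg (suc i)) (cong not (≢⇒≟-false (zero≢suc ∘ sym ∘ g-inj))))))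

  -- `h` takes the evidence `p i ≡ true`, so it need only be defined on the counted elements. The
  -- value of the first one is removed from the codomain by `punchOut`.
  injection⇒countTrue≤ : ∀ {a b} (p : Fin b → Bool) (h : ∀ i → p i ≡ true → Fin a) →
    (∀ {i j} pi pj → h i pi ≡ h j pj → i ≡ j) → countTrue p ≤ a
  injection⇒countTrue≤ {a} {zero}  p h h-inj = z≤n
  injection⇒countTrue≤ {a} {suc b} p h h-inj with p zero in p₀
  ... | false = injection⇒countTrue≤ (p ∘ suc) (h ∘ suc) (λ pi pj → sucF-injective ∘ h-inj pi pj)
  ... | true with a | h | h-inj
  ...   | zero  | h | _     with () ← h zero p₀
  ...   | suc a | h | h-inj = s≤s (injection⇒countTrue≤ (p ∘ suc)
    (λ i pi → punchOut (distinct₀ i pi))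
    (λ {i} {j} pi pj eq → sucF-injective (h-inj pi pj (punchOut-injective (distinct₀ i pi) (distinct₀ j pj) eq))))
    where
    distinct₀ : ∀ i pi → h zero p₀ ≢ h (suc i) pi
    distinct₀ i pi = zero≢suc ∘ h-inj p₀ pi

  -- The fold step of pick is local to its definition and can only be named by unification.
  pickFold : ∀ (rank : Fin n → Fin n) ok →
    Σ (Fin n → Maybe (Fin n) → Maybe (Fin n)) (λ step → pick rank ok ≡ foldr step nothing (allFin n))
  pickFold rank ok = _ , refl

  -- The invariant of the fold in `pick`. Minimality is stated with `≤`; strictness is recovered
  -- later from the injectivity of the ranking.
  Best : (Fin n → Fin n) → (Fin n → Bool) → List (Fin n) → Maybe (Fin n) → Set
  Best rank ok xs nothing  = All (λ s → ok s ≡ false) xs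
  Best rank ok xs (just s) = ok s ≡ true × All (λ t → ok t ≡ true → toℕ (rank s) ≤ toℕ (rank t)) xs

  best-step : ∀ (rank : Fin n → Fin n) ok x xs best → Best rank ok xs best →
    Best rank ok (x ∷ xs) (proj₁ (pickFold rank ok) x best)
  best-step rank ok x xs best b with ok x in okx
  best-step rank ok x xs nothing  b         | false = okx ∷ b
  best-step rank ok x xs (just t) (okt , b) | false = okt , (λ okx′ → contradiction okx (true≢false okx′)) ∷ b
  best-step rank ok x xs nothing  b         | true  =
    okx , (λ _ → ≤-refl) ∷ All.map (λ no-t okt → contradiction no-t (true≢false okt)) b
  best-step rank ok x xs (just t) (okt , b) | true with toℕ (rank x) <ᵇ toℕ (rank t) in lt
  ... | true  = okx , (λ _ → ≤-refl) ∷ All.map (λ t≤ oks → ≤-trans x≤t (t≤ oks)) b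
    where x≤t = <⇒≤ (<ᵇ⇒< (toℕ (rank x)) (toℕ (rank t)) (Equivalence.from T-≡ lt))
  ... | false = okt , (λ _ → ≮⇒≥ (λ x<t → true≢false (Equivalence.to T-≡ (<⇒<ᵇ x<t)) lt)) ∷ b

  best-foldr : ∀ (rank : Fin n → Fin n) ok xs →
    Best rank ok xs (foldr (proj₁ (pickFold rank ok)) nothing xs)
  best-foldr rank ok []       = []
  best-foldr rank ok (x ∷ xs) = best-step rank ok x xs _ (best-foldr rank ok xs)

  ∈-allFin : ∀ {n} (s : Fin n) → s ∈ allFin n
  ∈-allFin zero    = here refl
  ∈-allFin (suc s) = there (∈-map⁺ suc (∈-allFin s))

  pick-nothing : ∀ (rank : Fin n → Fin n) ok → pick rank ok ≡ nothing → ∀ s → ok s ≡ false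
  pick-nothing {n} rank ok eq s =
    All.lookup (subst (Best rank ok (allFin n)) eq (best-foldr rank ok (allFin n))) (∈-allFin s)

  pick-just : ∀ (rank : Fin n → Fin n) ok {s} → pick rank ok ≡ just s →
    ok s ≡ true × (∀ t → ok t ≡ true → toℕ (rank s) ≤ toℕ (rank t))
  pick-just {n} rank ok eq with subst (Best rank ok (allFin n)) eq (best-foldr rank ok (allFin n))
  ... | oks , least = oks , λ t → All.lookup least (∈-allFin t)

  -- A run of Ranking compared with `survivors`

  survivors-skip : ∀ ts x xs → (∀ {v} → v ∈ ts → x ≤ v) → survivors ts (x ∷ xs) ≡ survivors ts xs
  survivors-skip []       x xs x≤ = sym (survivors-[] xs)
  survivors-skip (t ∷ ts) x xs x≤ with t <ᵇ x in lt
  ... | true  = contradiction (x≤ (here refl)) (<⇒≱ (<ᵇ⇒< t x (Equivalence.from T-≡ lt)))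
  ... | false = refl

  survivors-take : ∀ {t x} ts xs → t < x → survivors (t ∷ ts) (x ∷ xs) ≡ survivors ts xs
  survivors-take ts xs t<x rewrite Equivalence.to T-≡ (<⇒<ᵇ t<x) = refl

  module Run (isT : Fin n → Bool) (rank : Fin n → Fin n)
             (rank-inj : ∀ {s t} → rank s ≡ rank t → s ≡ t) where

    -- A potential: the free servers other than targets, each good for at most one further match.
    idle : (Fin n → Bool) → ℕ
    idle matched = countTrue (λ s → not (isT s) ∧ not (matched s))

    idle-companion : ∀ matched s → isT s ≡ false → matched s ≡ false →
      idle matched ≡ suc (idle (λ t → matched t ∨ ⌊ t ≟ s ⌋))
    idle-companion matched s Ts ms = trans
      (countTrue-remove _ s (∧-intro (cong not Ts) (cong not ms)))
      (cong suc (countTrue-cong (λ t → lemma (not (isT t)) (matched t) ⌊ t ≟ s ⌋)))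
      where
      lemma : ∀ a b c → (a ∧ not b) ∧ not c ≡ a ∧ not (b ∨ c)
      lemma false b     c = refl
      lemma true  false c = refl
      lemma true  true  c = refl

    idle-target : ∀ matched s → isT s ≡ true → idle (λ t → matched t ∨ ⌊ t ≟ s ⌋) ≡ idle matched
    idle-target matched s Ts = countTrue-cong lemma
      where
      lemma : ∀ t → not (isT t) ∧ not (matched t ∨ ⌊ t ≟ s ⌋) ≡ not (isT t) ∧ not (matched t)
      lemma t with t ≟ s
      ... | yes refl rewrite Ts = refl
      ... | no _ with matched t
      ...   | false = refl
      ...   | true  = refl

    -- Once no request sees a target, every match uses up one idle server.
    run-without-targets : ∀ {m} (adj′ : Fin m → Fin n → Bool) matched →
      (∀ r s → isT s ≡ true → adj′ r s ≡ false) → runRanking rank adj′ matched ≤ idle matched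
    run-without-targets {zero}  adj′ matched avoid = z≤n
    run-without-targets {suc m} adj′ matched avoid
      with pick rank (λ s → adj′ zero s ∧ not (matched s)) in eq
    ... | nothing = run-without-targets (adj′ ∘ suc) matched (avoid ∘ suc)
    ... | just s with oks , _ ← pick-just rank (λ t → adj′ zero t ∧ not (matched t)) eq
                 with edge , free ← ∧-true oks = begin
      suc (runRanking rank (adj′ ∘ suc) (λ t → matched t ∨ ⌊ t ≟ s ⌋))
        ≤⟨ s≤s (run-without-targets (adj′ ∘ suc) _ (avoid ∘ suc)) ⟩
      suc (idle (λ t → matched t ∨ ⌊ t ≟ s ⌋))
        ≡⟨ idle-companion matched s (¬-not (λ Ts → true≢false edge (avoid zero s Ts))) (not-true free) ⟨
      idle matched ∎
      where open ≤-Reasoning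

    -- Ties the state of a run to the list that `survivors` works on. Strict sorting rules out
    -- duplicates, so dropping the head corresponds to matching exactly one target.
    record FreeTargets (matched : Fin n → Bool) (ts : List ℕ) : Set where
      field
        sorted   : AllPairs _<_ ts
        sound    : ∀ {v} → v ∈ ts → ∃ λ y → isT y ≡ true × matched y ≡ false × toℕ (rank y) ≡ v
        complete : ∀ y → isT y ≡ true → matched y ≡ false → toℕ (rank y) ∈ ts
    open FreeTargets

    free-companion : ∀ {matched ts s} → isT s ≡ false → FreeTargets matched ts →
      FreeTargets (λ t → matched t ∨ ⌊ t ≟ s ⌋) ts
    free-companion {matched} {ts} {s} Ts free = record
      { sorted   = sorted free
      ; sound    = λ v∈ → let y , Ty , my , ry = sound free v∈ in
          y , Ty , cong₂ _∨_ my (≢⇒≟-false (λ y≡s → true≢false Ty (trans (cong isT y≡s) Ts))) , ry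
      ; complete = λ y Ty my → complete free y Ty (∨-false my)
      }
      where
      ∨-false : ∀ {a b} → a ∨ b ≡ false → a ≡ false
      ∨-false {false} _ = refl

    free-target : ∀ {matched ts s} → isT s ≡ true → FreeTargets matched (toℕ (rank s) ∷ ts) →
      FreeTargets (λ t → matched t ∨ ⌊ t ≟ s ⌋) ts
    free-target {matched} {ts} {s} Ts free with sorted free
    ... | s< ∷ ts-sorted = record
      { sorted   = ts-sorted
      ; sound    = λ v∈ → let y , Ty , my , ry = sound free (there v∈) in
          y , Ty , cong₂ _∨_ my (≢⇒≟-false (λ y≡s → <⇒≢ (All.lookup s< v∈) (trans (cong (toℕ ∘ rank) (sym y≡s)) ry))) , ry
      ; complete = λ y Ty my → remaining y (complete free y Ty (proj₁ (∨-false my))) (proj₂ (∨-false my))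
      }
      where
      ∨-false : ∀ {a b} → a ∨ b ≡ false → a ≡ false × b ≡ false
      ∨-false {false} eq = refl , eq
      remaining : ∀ y → toℕ (rank y) ∈ toℕ (rank s) ∷ ts → ⌊ y ≟ s ⌋ ≡ false → toℕ (rank y) ∈ ts
      remaining y (there y∈) _ = y∈
      remaining y (here y≡s) y≢s with refl ← rank-inj (toℕ-injective y≡s) =
        contradiction y≢s (true≢false (≟-refl y))

    -- The right-hand side counts the free servers. Each match consumes one of them, and the targets
    -- that survive the first `a` requests stay free to the end because the later requests do not
    -- see them. The induction is on `a`.
    run-bound : ∀ a {b} (x : Fin a → Fin n) (adj′ : Fin (a + b) → Fin n → Bool) matched ts →
      (∀ {i j} → x i ≡ x j → i ≡ j) → (∀ i → isT (x i) ≡ false) → (∀ i → matched (x i) ≡ false) →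
      (∀ i s → adj′ (i ↑ˡ b) s ≡ isT s ∨ ⌊ s ≟ x i ⌋) →
      (∀ r s → isT s ≡ true → adj′ (a ↑ʳ r) s ≡ false) →
      FreeTargets matched ts →
      runRanking rank adj′ matched + survivors ts (List.tabulate (λ i → toℕ (rank (x i))))
        ≤ idle matched + List.length ts
    run-bound zero    x adj′ matched ts x-inj xT xm adj-main adj-rest free =
      +-monoˡ-≤ (List.length ts) (run-without-targets adj′ matched adj-rest)
    run-bound (suc a) {b} x adj′ matched ts x-inj xT xm adj-main adj-rest free
      with pick rank (λ s → adj′ zero s ∧ not (matched s)) in eq
    -- The request's own companion is adjacent and still free, so `pick` cannot fail.
    ... | nothing = contradiction (pick-nothing rank (λ t → adj′ zero t ∧ not (matched t)) eq (x zero))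
      (true≢false (∧-intro (trans (adj-main zero (x zero)) (trans (cong (isT (x zero) ∨_) (≟-refl (x zero))) (∨-zeroʳ _)))
                           (cong not (xm zero))))
    ... | just s with oks , least ← pick-just rank (λ t → adj′ zero t ∧ not (matched t)) eq
                 with edge , freeₛ ← ∧-true oks = by-role (isT s) refl
      where
      open ≤-Reasoning
      x₀ = toℕ (rank (x zero))
      xs = List.tabulate (λ i → toℕ (rank (x (suc i))))
      matched′ : Fin n → Bool
      matched′ t = matched t ∨ ⌊ t ≟ s ⌋
      R = runRanking rank (adj′ ∘ suc) matched′

      least-target : ∀ y → isT y ≡ true → matched y ≡ false → toℕ (rank s) ≤ toℕ (rank y)
      least-target y Ty my = least y
        (∧-intro (trans (adj-main zero y) (cong (_∨ ⌊ y ≟ x zero ⌋) Ty)) (cong not my))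

      least-x₀ : toℕ (rank s) ≤ x₀
      least-x₀ = least (x zero)
        (∧-intro (trans (adj-main zero (x zero)) (trans (cong (isT (x zero) ∨_) (≟-refl (x zero))) (∨-zeroʳ _)))
                 (cong not (xm zero)))

      least-ts : ∀ {v} → v ∈ ts → toℕ (rank s) ≤ v
      least-ts v∈ with y , Ty , my , refl ← sound free v∈ = least-target y Ty my

      induct : ∀ ts′ → (∀ i → x (suc i) ≢ s) → FreeTargets matched′ ts′ →
        R + survivors ts′ xs ≤ idle matched′ + List.length ts′
      induct ts′ x≢s = run-bound a (x ∘ suc) (adj′ ∘ suc) matched′ ts′ (sucF-injective ∘ x-inj) (xT ∘ suc)
        (λ i → cong₂ _∨_ (xm (suc i)) (≢⇒≟-false (x≢s i))) (adj-main ∘ suc) adj-rest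

      -- The chosen target has least rank among the free targets and `ts` is sorted, so its rank is
      -- the head of `ts`. It also beats the companion, strictly by injectivity, hence `survivors`
      -- drops the same target.
      by-target : isT s ≡ true → ∀ ts → toℕ (rank s) ∈ ts → FreeTargets matched ts →
        (∀ {v} → v ∈ ts → toℕ (rank s) ≤ v) →
        suc R + survivors ts (x₀ ∷ xs) ≤ idle matched + List.length ts
      by-target Ts (t ∷ ts) (there s∈) free least with t< ∷ _ ← sorted free =
        contradiction (least (here refl)) (<⇒≱ (All.lookup t< s∈))
      by-target Ts (_ ∷ ts) (here refl) free least = begin
        suc R + survivors (toℕ (rank s) ∷ ts) (x₀ ∷ xs)
          ≡⟨ cong (suc R +_) (survivors-take ts xs (≤∧≢⇒< least-x₀
               (λ r → s≢x zero (sym (rank-inj (toℕ-injective r)))))) ⟩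
        suc (R + survivors ts xs)
          ≤⟨ s≤s (induct ts (s≢x ∘ suc) (free-target Ts free)) ⟩
        suc (idle matched′ + List.length ts)
          ≡⟨ cong (λ i → suc (i + List.length ts)) (idle-target matched s Ts) ⟩
        suc (idle matched + List.length ts)
          ≡⟨ +-suc (idle matched) _ ⟨
        idle matched + suc (List.length ts) ∎
        where
        s≢x : ∀ i → x i ≢ s
        s≢x i refl = true≢false Ts (xT i)

      -- Here every free target has rank at least that of the companion, so `survivors` keeps them
      -- all and the match is paid for by `idle`.
      by-companion : isT s ≡ false → s ≡ x zero → suc R + survivors ts (x₀ ∷ xs) ≤ idle matched + List.length ts
      by-companion Ts s≡x₀ = begin
        suc R + survivors ts (x₀ ∷ xs)
          ≡⟨ cong (suc R +_) (survivors-skip ts x₀ xs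
               (λ v∈ → subst (λ z → toℕ (rank z) ≤ _) s≡x₀ (least-ts v∈))) ⟩
        suc (R + survivors ts xs)
          ≤⟨ s≤s (induct ts (λ i xi≡s → zero≢suc (sym (x-inj (trans xi≡s s≡x₀)))) (free-companion Ts free)) ⟩
        suc (idle matched′ + List.length ts)
          ≡⟨ cong (_+ List.length ts) (idle-companion matched s Ts (not-true freeₛ)) ⟨
        idle matched + List.length ts ∎

      by-role : ∀ b → isT s ≡ b → suc R + survivors ts (x₀ ∷ xs) ≤ idle matched + List.length ts
      by-role true  Ts = by-target Ts ts (complete free s Ts (not-true freeₛ)) free least-ts
      by-role false Ts = by-companion Ts (≟-true⇒≡ (trans (sym (trans (adj-main zero s) (cong (_∨ ⌊ s ≟ x zero ⌋) Ts))) edge))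

  -- The sorted list of target ranks

  ∈-insert⁻ : ∀ {w} v xs → w ∈ insert v xs → w ≡ v ⊎ w ∈ xs
  ∈-insert⁻ v []       (here w≡v) = inj₁ w≡v
  ∈-insert⁻ v (x ∷ xs) w∈ with x <ᵇ v
  ∈-insert⁻ v (x ∷ xs) (here w≡x)  | true  = inj₂ (here w≡x)
  ∈-insert⁻ v (x ∷ xs) (there w∈)  | true  with ∈-insert⁻ v xs w∈
  ... | inj₁ w≡v = inj₁ w≡v
  ... | inj₂ w∈′ = inj₂ (there w∈′)
  ∈-insert⁻ v (x ∷ xs) (here w≡v)  | false = inj₁ w≡v
  ∈-insert⁻ v (x ∷ xs) (there w∈)  | false = inj₂ w∈

  ∈-insert⁺ˡ : ∀ v xs → v ∈ insert v xs
  ∈-insert⁺ˡ v []       = here refl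
  ∈-insert⁺ˡ v (x ∷ xs) with x <ᵇ v
  ... | true  = there (∈-insert⁺ˡ v xs)
  ... | false = here refl

  ∈-insert⁺ʳ : ∀ {w} v xs → w ∈ xs → w ∈ insert v xs
  ∈-insert⁺ʳ v (x ∷ xs) w∈ with x <ᵇ v
  ∈-insert⁺ʳ v (x ∷ xs) (here w≡x) | true  = here w≡x
  ∈-insert⁺ʳ v (x ∷ xs) (there w∈) | true  = there (∈-insert⁺ʳ v xs w∈)
  ∈-insert⁺ʳ v (x ∷ xs) w∈         | false = there w∈

  insert-sorted : ∀ v xs → AllPairs _<_ xs → v ∉ xs → AllPairs _<_ (insert v xs)
  insert-sorted v []       []             v∉ = [] ∷ []
  insert-sorted v (x ∷ xs) (x< ∷ sorted) v∉ with x <ᵇ v in lt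
  ... | true  = All.tabulate (λ w∈ → below (∈-insert⁻ v xs w∈)) ∷ insert-sorted v xs sorted (v∉ ∘ there)
    where
    below : ∀ {w} → w ≡ v ⊎ w ∈ xs → x < w
    below (inj₁ refl) = <ᵇ⇒< x v (Equivalence.from T-≡ lt)
    below (inj₂ w∈)   = All.lookup x< w∈
  ... | false = (v<x ∷ All.map (<-trans v<x) x<) ∷ x< ∷ sorted
    where
    v<x : v < x
    v<x = ≤∧≢⇒< (≮⇒≥ (λ x<v → true≢false (Equivalence.to T-≡ (<⇒<ᵇ x<v)) lt)) (v∉ ∘ here)

  isTargetᵇ : Role → Bool
  isTargetᵇ target = true
  isTargetᵇ _      = false

  targets-sound : ∀ {n} (rs : Vec Role n) (g : Fin n → ℕ) {v} → v ∈ targets rs (Vec.tabulate g) →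
    ∃ λ y → isTargetᵇ (lookup rs y) ≡ true × g y ≡ v
  targets-sound (target ∷ rs) g v∈ with ∈-insert⁻ (g zero) (targets rs (Vec.tabulate (g ∘ suc))) v∈
  ... | inj₁ refl = zero , refl , refl
  ... | inj₂ v∈′  with y , Ty , gy ← targets-sound rs (g ∘ suc) v∈′ = suc y , Ty , gy
  targets-sound (companion ∷ rs) g v∈ with y , Ty , gy ← targets-sound rs (g ∘ suc) v∈ = suc y , Ty , gy
  targets-sound (inert     ∷ rs) g v∈ with y , Ty , gy ← targets-sound rs (g ∘ suc) v∈ = suc y , Ty , gy

  targets-complete : ∀ {n} (rs : Vec Role n) (g : Fin n → ℕ) y → isTargetᵇ (lookup rs y) ≡ true →
    g y ∈ targets rs (Vec.tabulate g)
  targets-complete (target    ∷ rs) g zero    Ty = ∈-insert⁺ˡ (g zero) (targets rs (Vec.tabulate (g ∘ suc)))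
  targets-complete (target    ∷ rs) g (suc y) Ty = ∈-insert⁺ʳ (g zero) (targets rs (Vec.tabulate (g ∘ suc))) (targets-complete rs (g ∘ suc) y Ty)
  targets-complete (companion ∷ rs) g (suc y) Ty = targets-complete rs (g ∘ suc) y Ty
  targets-complete (inert     ∷ rs) g (suc y) Ty = targets-complete rs (g ∘ suc) y Ty

  targets-sorted : ∀ {n} (rs : Vec Role n) (g : Fin n → ℕ) → (∀ {i j} → g i ≡ g j → i ≡ j) →
    AllPairs _<_ (targets rs (Vec.tabulate g))
  targets-sorted []               g g-inj = []
  targets-sorted (target    ∷ rs) g g-inj =
    insert-sorted (g zero) (targets rs (Vec.tabulate (g ∘ suc))) (targets-sorted rs (g ∘ suc) (sucF-injective ∘ g-inj))
      (λ g₀∈ → let y , _ , gy = targets-sound rs (g ∘ suc) g₀∈ in zero≢suc (g-inj (sym gy)))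
  targets-sorted (companion ∷ rs) g g-inj = targets-sorted rs (g ∘ suc) (sucF-injective ∘ g-inj)
  targets-sorted (inert     ∷ rs) g g-inj = targets-sorted rs (g ∘ suc) (sucF-injective ∘ g-inj)

  -- Sums over rankings as sums over injections

  sum-map-allFin : ∀ m (φ : Fin m → ℕ) → sumL (List.map φ (allFin m)) ≡ sum φ
  sum-map-allFin zero    φ = refl
  sum-map-allFin (suc m) φ = cong (φ zero +_)
    (trans (cong sumL (sym (map-∘ (allFin m)))) (sum-map-allFin m (φ ∘ suc)))

  sum-concatMap : ∀ {A B : Set} (h : B → ℕ) (f : A → List B) xs →
    sumL (List.map h (concatMap f xs)) ≡ sumL (List.map (λ x → sumL (List.map h (f x))) xs)
  sum-concatMap h f []       = refl
  sum-concatMap h f (x ∷ xs) = begin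
    sumL (List.map h (f x List.++ concatMap f xs))
      ≡⟨ cong sumL (map-++ h (f x) (concatMap f xs)) ⟩
    sumL (List.map h (f x) List.++ List.map h (concatMap f xs))
      ≡⟨ sum-++ (List.map h (f x)) _ ⟩
    sumL (List.map h (f x)) + sumL (List.map h (concatMap f xs))
      ≡⟨ cong (sumL (List.map h (f x)) +_) (sum-concatMap h f xs) ⟩
    sumL (List.map h (f x)) + sumL (List.map (λ x → sumL (List.map h (f x))) xs) ∎
    where open ≡-Reasoning

  ranks : ∀ {n m} → (Fin n → Fin m) → Vec ℕ n
  ranks f = Vec.tabulate (toℕ ∘ f)

  sum-allFuns : ∀ n m (h : Vec ℕ n → ℕ) → sumL (List.map (h ∘ ranks) (allFuns n m)) ≡ ∑ⱽ n m h
  sum-allFuns zero    m h = +-identityʳ (h [])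
  sum-allFuns (suc n) m h = begin
    sumL (List.map (h ∘ ranks) (allFuns (suc n) m))
      ≡⟨ sum-concatMap (h ∘ ranks) (λ f → List.map (λ i → i VF.∷ f) (allFin m)) (allFuns n m) ⟩
    sumL (List.map (λ f → sumL (List.map (h ∘ ranks) (List.map (λ i → i VF.∷ f) (allFin m)))) (allFuns n m))
      ≡⟨ cong sumL (map-cong (λ f → trans (cong sumL (sym (map-∘ (allFin m)))) (sum-map-allFin m _)) (allFuns n m)) ⟩
    sumL (List.map (λ f → sum {m} (λ i → h (toℕ i ∷ ranks f))) (allFuns n m))
      ≡⟨ sum-allFuns n m (λ l → sum {m} (λ i → h (toℕ i ∷ l))) ⟩
    -- `allFuns` varies the first value in its inner loop, while `∑ⱽ` sums over it outermost, so the
    -- two sums are exchanged.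
    ∑ⱽ n m (λ l → sum {m} (λ i → h (toℕ i ∷ l)))
      ≡⟨ ∑ⱽ-∑-comm n m {m} (λ i l → h (toℕ i ∷ l)) ⟨
    ∑ⱽ (suc n) m h ∎
    where open ≡-Reasoning

  ≡-of-truth : ∀ {a b} → (a ≡ true → b ≡ true) → (b ≡ true → a ≡ true) → a ≡ b
  ≡-of-truth {true}          a⇒b b⇒a = sym (a⇒b refl)
  ≡-of-truth {false} {false} a⇒b b⇒a = refl
  ≡-of-truth {false} {true}  a⇒b b⇒a = b⇒a refl

  allB⁻ : (p : Fin n → Bool) → allB p ≡ true → ∀ i → p i ≡ true
  allB⁻ {n} p all i = go (allFin n) all (∈-allFin i)
    where
    go : ∀ xs → foldr (λ i b → p i ∧ b) true xs ≡ true → ∀ {i} → i ∈ xs → p i ≡ true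
    go (x ∷ xs) all (here refl) = proj₁ (∧-true all)
    go (x ∷ xs) all (there i∈)  = go xs (proj₂ (∧-true {p x} all)) i∈

  allB⁺ : (p : Fin n → Bool) → (∀ i → p i ≡ true) → allB p ≡ true
  allB⁺ {n} p all = go (allFin n)
    where
    go : ∀ xs → foldr (λ i b → p i ∧ b) true xs ≡ true
    go []       = refl
    go (x ∷ xs) = ∧-intro (all x) (go xs)

  injectiveB⁻ : (f : Fin n → Fin n) → injectiveB f ≡ true → ∀ {i j} → f i ≡ f j → i ≡ j
  injectiveB⁻ f inj {i} {j} fi≡fj = ≟-true⇒≡ (subst (λ b → not b ∨ ⌊ i ≟ j ⌋ ≡ true) f-agree
    (allB⁻ (λ j → not ⌊ f i ≟ f j ⌋ ∨ ⌊ i ≟ j ⌋)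
      (allB⁻ (λ i → allB (λ j → not ⌊ f i ≟ f j ⌋ ∨ ⌊ i ≟ j ⌋)) inj i) j))
    where
    f-agree : ⌊ f i ≟ f j ⌋ ≡ true
    f-agree = trans (cong (λ z → ⌊ f i ≟ z ⌋) (sym fi≡fj)) (≟-refl (f i))

  injectiveB⁺ : (f : Fin n → Fin n) → (∀ {i j} → f i ≡ f j → i ≡ j) → injectiveB f ≡ true
  injectiveB⁺ f f-inj = allB⁺ _ (λ i → allB⁺ _ (separated i))
    where
    separated : ∀ i j → not ⌊ f i ≟ f j ⌋ ∨ ⌊ i ≟ j ⌋ ≡ true
    separated i j with f i ≟ f j
    ... | no  _     = refl
    ... | yes fi≡fj rewrite f-inj fi≡fj = ≟-refl j

  mem⁻ : ∀ {n} v (g : Fin n → ℕ) → mem v (Vec.tabulate g) ≡ true → ∃ λ i → v ≡ g i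
  mem⁻ {suc n} v g v∈ with v ≡ᵇ g zero in eq
  ... | true  = zero , ≡ᵇ⇒≡ v (g zero) (Equivalence.from T-≡ eq)
  ... | false with i , v≡ ← mem⁻ v (g ∘ suc) v∈ = suc i , v≡

  mem⁺ : ∀ {n} (g : Fin n → ℕ) i → mem (g i) (Vec.tabulate g) ≡ true
  mem⁺ g zero    rewrite Equivalence.to T-≡ (≡⇒≡ᵇ (g zero) (g zero) refl) = refl
  mem⁺ g (suc i) rewrite mem⁺ (g ∘ suc) i = ∨-zeroʳ _

  distinct⁻ : ∀ {n} (g : Fin n → ℕ) → distinct (Vec.tabulate g) ≡ true → ∀ {i j} → g i ≡ g j → i ≡ j
  distinct⁻ g d {zero}  {zero}  eq = refl
  distinct⁻ g d {suc i} {suc j} eq = cong suc (distinct⁻ (g ∘ suc) (proj₂ (∧-true d)) eq)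
  distinct⁻ g d {zero}  {suc j} eq = contradiction (not-true (proj₁ (∧-true d)))
    (true≢false (subst (λ v → mem v (Vec.tabulate (g ∘ suc)) ≡ true) (sym eq) (mem⁺ (g ∘ suc) j)))
  distinct⁻ g d {suc i} {zero}  eq = contradiction (not-true (proj₁ (∧-true d)))
    (true≢false (subst (λ v → mem v (Vec.tabulate (g ∘ suc)) ≡ true) eq (mem⁺ (g ∘ suc) i)))

  distinct⁺ : ∀ {n} (g : Fin n → ℕ) → (∀ {i j} → g i ≡ g j → i ≡ j) → distinct (Vec.tabulate g) ≡ true
  distinct⁺ {zero}  g g-inj = refl
  distinct⁺ {suc n} g g-inj = ∧-intro
    (cong not (¬-not (λ g₀∈ → zero≢suc (g-inj (proj₂ (mem⁻ (g zero) (g ∘ suc) g₀∈))))))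
    (distinct⁺ (g ∘ suc) (sucF-injective ∘ g-inj))

  injectiveB≡distinct : (f : Fin n → Fin n) → injectiveB f ≡ distinct (ranks f)
  injectiveB≡distinct f = ≡-of-truth
    (λ inj → distinct⁺ (toℕ ∘ f) (injectiveB⁻ f inj ∘ toℕ-injective))
    (λ d → injectiveB⁺ f (distinct⁻ (toℕ ∘ f) d ∘ cong toℕ))

  sum-filterᵇ : ∀ {A : Set} (p : A → Bool) (φ : A → ℕ) xs →
    sumL (List.map φ (filterᵇ p xs)) ≡ sumL (List.map (λ x → indicator (p x) * φ x) xs)
  sum-filterᵇ p φ []       = refl
  sum-filterᵇ p φ (x ∷ xs) with p x
  ... | true  = cong₂ _+_ (sym (+-identityʳ (φ x))) (sum-filterᵇ p φ xs)
  ... | false = sum-filterᵇ p φ xs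

  sum-allRankings : ∀ n (h : Vec ℕ n → ℕ) → sumL (List.map (h ∘ ranks) (allRankings n)) ≡ ∑ᴵ n n h
  sum-allRankings n h = begin
    sumL (List.map (h ∘ ranks) (allRankings n))
      ≡⟨ sum-filterᵇ injectiveB (h ∘ ranks) (allFuns n n) ⟩
    sumL (List.map (λ f → indicator (injectiveB f) * h (ranks f)) (allFuns n n))
      ≡⟨ cong sumL (map-cong (λ f → cong (λ b → indicator b * h (ranks f)) (injectiveB≡distinct f)) (allFuns n n)) ⟩
    sumL (List.map (λ f → indicator (distinct (ranks f)) * h (ranks f)) (allFuns n n))
      ≡⟨ sum-allFuns n n (λ l → indicator (distinct l) * h l) ⟩
    ∑ᴵ n n h ∎
    where open ≡-Reasoning

  length≡sum : ∀ {A : Set} (xs : List A) → length xs ≡ sumL (List.map (λ _ → 1) xs)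
  length≡sum []       = refl
  length≡sum (x ∷ xs) = cong suc (length≡sum xs)

  -- Sums a pointwise bound over the rankings. The bound is asked only where `p` holds, which is how
  -- each ranking supplies its injectivity.
  sum-filterᵇ-≤ : ∀ {A : Set} (p : A → Bool) (φ ψ : A → ℕ) c xs → (∀ x → p x ≡ true → φ x + ψ x ≤ c) →
    sumL (List.map φ (filterᵇ p xs)) + sumL (List.map ψ (filterᵇ p xs)) ≤ c * length (filterᵇ p xs)
  sum-filterᵇ-≤ p φ ψ c []       bound = z≤n
  sum-filterᵇ-≤ p φ ψ c (x ∷ xs) bound with p x in px
  ... | false = sum-filterᵇ-≤ p φ ψ c xs bound
  ... | true  = begin
    (φ x + Φ) + (ψ x + Ψ)   ≡⟨ +-interchange (φ x) Φ (ψ x) Ψ ⟩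
    (φ x + ψ x) + (Φ + Ψ)   ≤⟨ +-mono-≤ (bound x px) (sum-filterᵇ-≤ p φ ψ c xs bound) ⟩
    c + c * length (filterᵇ p xs) ≡⟨ *-suc c _ ⟨
    c * suc (length (filterᵇ p xs)) ∎
    where
    open ≤-Reasoning
    Φ = sumL (List.map φ (filterᵇ p xs))
    Ψ = sumL (List.map ψ (filterᵇ p xs))

  -- The hard instances

  fromIsJust : ∀ {A : Set} (m : Maybe A) → isJust m ≡ true → Σ A λ a → m ≡ just a
  fromIsJust (just a) _ = a , refl

  size≤servers : ∀ {I} (M : Matching I) → size M ≤ nS I
  size≤servers M = injection⇒countTrue≤ (isJust ∘ mate M) (λ r → proj₁ ∘ fromIsJust (mate M r))
    (λ {r} {r′} matched matched′ eq → let s , ms = fromIsJust (mate M r) matched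
                                          s′ , ms′ = fromIsJust (mate M r′) matched′
                                      in injMate M r r′ s′ (trans ms (cong just eq)) ms′)

  module _ (I : Instance) (home : Fin (nS I) → Fin (nR I))
           (home-inj : ∀ {s t} → home s ≡ home t → s ≡ t)
           (home-edge : ∀ s → adj I (home s) s ≡ true) where

    -- The partial inverse of `home`, found by search, since a matching is given from the side of
    -- the requests.
    occupant : Fin (nR I) → Maybe (Fin (nS I))
    occupant r with any? (λ s → home s ≟ r)
    ... | yes (s , _) = just s
    ... | no  _       = nothing

    occupant⇒home : ∀ r s → occupant r ≡ just s → home s ≡ r
    occupant⇒home r s eq with any? (λ s → home s ≟ r)
    occupant⇒home r s refl | yes (_ , hs≡r) = hs≡r

    occupied : ∀ s → isJust (occupant (home s)) ≡ true
    occupied s with any? (λ t → home t ≟ home s)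
    ... | yes _    = refl
    ... | no  none = contradiction (s , refl) none

    saturating : Matching I
    saturating = record
      { mate    = occupant
      ; edge    = λ r s eq → subst (λ r → adj I r s ≡ true) (occupant⇒home r s eq) (home-edge s)
      ; injMate = λ r r′ s eq eq′ → trans (sym (occupant⇒home r s eq)) (occupant⇒home r′ s eq′)
      }

    size-saturating : size saturating ≡ nS I
    size-saturating = ≤-antisym (size≤servers saturating)
      (injection⇒≤countTrue (isJust ∘ occupant) home home-inj occupied)

  roles : ∀ k N → Vec Role (k + N)
  roles k N = replicate k companion ++ replicate N target

  count-roles-target : ∀ k N → count isTarget (roles k N) ≡ N
  count-roles-target (suc k) N       = count-roles-target k N
  count-roles-target zero    zero    = refl
  count-roles-target zero    (suc N) = cong suc (count-roles-target zero N)

  count-roles-companion : ∀ k N → count isCompanion (roles k N) ≡ k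
  count-roles-companion (suc k) N       = cong suc (count-roles-companion k N)
  count-roles-companion zero    zero    = refl
  count-roles-companion zero    (suc N) = count-roles-companion zero N

  companions-roles : ∀ k N (g : Fin (k + N) → ℕ) →
    companions (roles k N) (Vec.tabulate g) ≡ List.tabulate (λ i → g (i ↑ˡ N))
  companions-roles zero    N g = no-companions (roles zero N) (Vec.tabulate g) (count-roles-companion zero N)
  companions-roles (suc k) N g = cong (g zero ∷_) (companions-roles k N (g ∘ suc))

  isTargetServer : ∀ k N → Fin (k + N) → Bool
  isTargetServer k N s = isTargetᵇ (lookup (roles k N) s)

  isTargetServer-↑ˡ : ∀ k N i → isTargetServer k N (i ↑ˡ N) ≡ false
  isTargetServer-↑ˡ k N i = cong isTargetᵇ (trans (lookup-++ˡ (replicate k companion) (replicate N target) i) (lookup-replicate i companion))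

  isTargetServer-↑ʳ : ∀ k N t → isTargetServer k N (k ↑ʳ t) ≡ true
  isTargetServer-↑ʳ k N t = cong isTargetᵇ (trans (lookup-++ʳ (replicate k companion) (replicate N target) t) (lookup-replicate t target))

  -- The k + N servers are the companions 0, …, k−1 followed by N targets; request (q , i) of the k × k
  -- requests is adjacent to companion i, and in the first round q = 0 also to all targets.
  serves : ∀ {k N} → Fin k × Fin k → Fin k ⊎ Fin N → Bool
  serves (q     , i) (inj₁ j) = ⌊ j ≟ i ⌋
  serves (zero  , i) (inj₂ t) = true
  serves (suc q , i) (inj₂ t) = false

  hard : ℕ → ℕ → Instance
  hard k N = record { nS = k + N ; nR = k * k ; adj = λ r s → serves {k} {N} (remQuot k r) (splitAt k s) }

  serves-combine : ∀ {k N} (q i : Fin k) (x : Fin k ⊎ Fin N) → serves (remQuot k (combine q i)) x ≡ serves (q , i) x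
  serves-combine q i x = cong (λ p → serves p x) (remQuot-combine q i)

  splitAt-injective : ∀ m {n} {i j : Fin (m + n)} → splitAt m i ≡ splitAt m j → i ≡ j
  splitAt-injective m {n} {i} {j} eq =
    trans (sym (join-splitAt m n i)) (trans (cong (join m n) eq) (join-splitAt m n j))

  -- A companion meets one request in each of the `suc k` rounds; a target meets all `suc k`
  -- requests of the first round.
  server-degree : ∀ k N (x : Fin (suc k) ⊎ Fin N) → suc k ≤ countTrue (λ r → serves (remQuot (suc k) r) x)
  server-degree k N (inj₁ j) = injection⇒≤countTrue
    (λ r → serves {suc k} {N} (remQuot (suc k) r) (inj₁ j)) (λ q → combine {suc k} {suc k} q j)
    (λ {q} {q′} → combine-injectiveˡ q j q′ j)
    (λ q → trans (serves-combine {suc k} {N} q j (inj₁ j)) (≟-refl j))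
  server-degree k N (inj₂ t) = injection⇒≤countTrue
    (λ r → serves {suc k} {N} (remQuot (suc k) r) (inj₂ t)) (combine {suc k} {suc k} zero)
    (λ {i} {i′} → combine-injectiveʳ {suc k} {suc k} zero i zero i′)
    (λ i → serves-combine {suc k} {N} zero i (inj₂ t))

  -- All companions may share one slot, because a request is adjacent to only one of them; the
  -- targets fill the other `N`.
  request-degree : ∀ k N (p : Fin k × Fin k) → countTrue (λ s → serves {k} {N} p (splitAt k s)) ≤ suc N
  request-degree k N p = injection⇒countTrue≤ _ (λ s _ → slot (splitAt k s))
    (λ {s} {s′} e e′ eq → splitAt-injective k (slot-inj p (splitAt k s) (splitAt k s′) e e′ eq))
    where
    slot : Fin k ⊎ Fin N → Fin (suc N)
    slot (inj₁ _) = zero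
    slot (inj₂ t) = suc t
    slot-inj : ∀ p x y → serves p x ≡ true → serves p y ≡ true → slot x ≡ slot y → x ≡ y
    slot-inj p (inj₁ j) (inj₁ j′) e e′ eq   = cong inj₁ (trans (≟-true⇒≡ e) (sym (≟-true⇒≡ e′)))
    slot-inj p (inj₂ t) (inj₂ .t) e e′ refl = refl

  hard-bounded : ∀ k N → Bounded (suc k) (suc N) (hard (suc k) N)
  hard-bounded k N = (λ s → server-degree k N (splitAt (suc k) s)) , (λ r → request-degree (suc k) N (remQuot (suc k) r))

  module _ (j N : ℕ) (N≤k : N ≤ 2 + j) where
    private
      k = 2 + j

    -- Targets are served in the first round, which has room for them as `N ≤ k`, and companions in
    -- the second, which exists as `k` is at least 2.
    home : Fin k ⊎ Fin N → Fin (k * k)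
    home (inj₁ i) = combine {k} {k} (suc zero) i
    home (inj₂ t) = combine {k} {k} zero (inject≤ t N≤k)

    home-inj : ∀ x y → home x ≡ home y → x ≡ y
    home-inj (inj₁ i) (inj₁ i′) eq = cong inj₁ (combine-injectiveʳ {k} {k} (suc zero) i (suc zero) i′ eq)
    home-inj (inj₂ t) (inj₂ t′) eq = cong inj₂ (inject≤-injective N≤k N≤k t t′
      (combine-injectiveʳ {k} {k} zero (inject≤ t N≤k) zero (inject≤ t′ N≤k) eq))
    home-inj (inj₁ i) (inj₂ t)  eq
      with () ← combine-injectiveˡ {k} {k} (suc zero) i zero (inject≤ t N≤k) eq
    home-inj (inj₂ t) (inj₁ i)  eq
      with () ← combine-injectiveˡ {k} {k} zero (inject≤ t N≤k) (suc zero) i eq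

    home-edge : ∀ x → serves {k} {N} (remQuot {k} k (home x)) x ≡ true
    home-edge (inj₁ i) = trans (serves-combine {k} {N} (suc zero) i (inj₁ i)) (≟-refl i)
    home-edge (inj₂ t) = serves-combine {k} {N} zero (inject≤ t N≤k) (inj₂ t)

    hard-matching : Matching (hard k N)
    hard-matching = saturating (hard k N) (home ∘ splitAt k)
      (λ {s} {t} eq → splitAt-injective k (home-inj (splitAt k s) (splitAt k t) eq)) (home-edge ∘ splitAt k)

    size-hard-matching : size hard-matching ≡ k + N
    size-hard-matching = size-saturating (hard k N) (home ∘ splitAt k)
      (λ {s} {t} eq → splitAt-injective k (home-inj (splitAt k s) (splitAt k t) eq)) (home-edge ∘ splitAt k)

  -- Puts adjacency into the form required by `run-bound`; `combine zero i` reduces to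
  -- `i ↑ˡ (k * suc k)`.
  serves-first-round : ∀ k N i s →
    serves {suc k} {N} (remQuot (suc k) (combine {suc k} {suc k} zero i)) (splitAt (suc k) s) ≡ isTargetServer (suc k) N s ∨ ⌊ s ≟ i ↑ˡ N ⌋
  serves-first-round k N i s = trans (serves-combine zero i (splitAt (suc k) s))
    (trans (by-side (splitAt (suc k) s))
           (cong (λ s → isTargetServer (suc k) N s ∨ ⌊ s ≟ i ↑ˡ N ⌋) (join-splitAt (suc k) N s)))
    where
    ↑ˡ-≟ : ∀ j → ⌊ j ≟ i ⌋ ≡ ⌊ j ↑ˡ N ≟ i ↑ˡ N ⌋
    ↑ˡ-≟ j with j ≟ i
    ... | yes refl = sym (≟-refl (j ↑ˡ N))
    ... | no  j≢i  = sym (≢⇒≟-false (j≢i ∘ ↑ˡ-injective N j i))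
    by-side : ∀ x → serves {suc k} {N} (zero , i) x ≡
      isTargetServer (suc k) N (join (suc k) N x) ∨ ⌊ join (suc k) N x ≟ i ↑ˡ N ⌋
    by-side (inj₁ j) = trans (↑ˡ-≟ j) (cong (_∨ ⌊ j ↑ˡ N ≟ i ↑ˡ N ⌋) (sym (isTargetServer-↑ˡ (suc k) N j)))
    by-side (inj₂ t) = cong (_∨ ⌊ suc k ↑ʳ t ≟ i ↑ˡ N ⌋) (sym (isTargetServer-↑ʳ (suc k) N t))

  serves-later-round : ∀ k N r s → isTargetServer (suc k) N s ≡ true →
    serves {suc k} {N} (remQuot (suc k) (suc k ↑ʳ r)) (splitAt (suc k) s) ≡ false
  serves-later-round k N r s Ts rewrite splitAt-↑ʳ (suc k) (k * suc k) r with splitAt (suc k) s in eq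
  ... | inj₂ t = refl
  ... | inj₁ j = contradiction (isTargetServer-↑ˡ (suc k) N j)
    (true≢false (trans (cong (isTargetServer (suc k) N)
      (trans (cong (join (suc k) N) (sym eq)) (join-splitAt (suc k) N s))) Ts))

  idle-companions : ∀ k N → countTrue (λ s → not (isTargetServer k N s) ∧ not false) ≤ k
  idle-companions k N = injection⇒countTrue≤ _ (λ s free → proj₁ (companion-index s free))
    (λ {s} {s′} free free′ eq → trans (proj₂ (companion-index s free))
      (trans (cong (_↑ˡ N) eq) (sym (proj₂ (companion-index s′ free′)))))
    where
    companion-index : ∀ s → not (isTargetServer k N s) ∧ true ≡ true → Σ (Fin k) λ i → s ≡ i ↑ˡ N
    companion-index s free with splitAt k s | join-splitAt k N s
    ... | inj₁ i | eq   = i , sym eq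
    ... | inj₂ t | refl = contradiction (isTargetServer-↑ʳ k N t) (λ Ts → true≢false Ts (not-true (proj₁ (∧-true free))))

  -- All servers are free at the start, so the potential in `run-bound` begins at the number of
  -- servers.
  ranking-on-hard : ∀ k N (rank : Fin (suc k + N) → Fin (suc k + N)) → (∀ {i j} → rank i ≡ rank j → i ≡ j) →
    runRanking rank (adj (hard (suc k) N)) (λ _ → false) + unmatched (roles (suc k) N) (ranks rank) ≤ suc k + N
  ranking-on-hard k N rank rank-inj = begin
    R + unmatched rs (ranks rank)
      ≡⟨ cong (λ xs → R + survivors ts xs) (companions-roles (suc k) N (toℕ ∘ rank)) ⟩
    R + survivors ts (List.tabulate (λ i → toℕ (rank (i ↑ˡ N))))
      ≤⟨ run-bound (suc k) (_↑ˡ N) (adj (hard (suc k) N)) (λ _ → false) ts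
           (↑ˡ-injective N _ _) (isTargetServer-↑ˡ (suc k) N) (λ _ → refl)
           (serves-first-round k N) (serves-later-round k N) initial ⟩
    idle (λ _ → false) + List.length ts
      ≤⟨ +-mono-≤ (idle-companions (suc k) N)
           (≤-reflexive (trans (length-targets rs (ranks rank)) (count-roles-target (suc k) N))) ⟩
    suc k + N ∎
    where
    open ≤-Reasoning
    rs = roles (suc k) N
    ts = targets rs (ranks rank)
    R = runRanking rank (adj (hard (suc k) N)) (λ _ → false)
    open Run (isTargetServer (suc k) N) rank rank-inj
    initial : FreeTargets (λ _ → false) ts
    initial = record
      { sorted   = targets-sorted rs (toℕ ∘ rank) (rank-inj ∘ toℕ-injective)
      ; sound    = λ v∈ → let y , Ty , ry = targets-sound rs (toℕ ∘ rank) v∈ in y , Ty , refl , ry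
      ; complete = λ y Ty _ → targets-complete rs (toℕ ∘ rank) y Ty
      }

  -- Averaging over all rankings

  totalRanking : Instance → ℕ
  totalRanking I = sumL (List.map (λ rank → runRanking rank (adj I) (λ _ → false)) (allRankings (nS I)))

  length-allRankings : ∀ n → length (allRankings n) ≡ injections n n
  length-allRankings n = trans (length≡sum (allRankings n)) (sum-allRankings n (λ _ → 1))

  -- Summing `ranking-on-hard` over the rankings bounds matches plus survivors by S per ranking; the
  -- survivors are then replaced by their lower bound.
  totalRanking-hard : ∀ k N → let S = suc k + N in
    suc N ^ suc k * totalRanking (hard (suc k) N) + N ^ suc (suc k) * length (allRankings S)
      ≤ suc N ^ suc k * (S * length (allRankings S))
  totalRanking-hard k N = begin
    D * A + P * L          ≡⟨ cong (λ c → D * A + P * c) (length-allRankings S) ⟩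
    D * A + P * injections S S
      ≤⟨ +-monoʳ-≤ (D * A) (∑ᴵ-unmatched S rs N (suc k) (count-roles-target (suc k) N) (count-roles-companion (suc k) N)) ⟩
    D * A + D * ∑ᴵ S S (unmatched rs)
      ≡⟨ cong (λ U → D * A + D * U) (sum-allRankings S (unmatched rs)) ⟨
    D * A + D * U          ≡⟨ *-distribˡ-+ D A U ⟨
    D * (A + U)
      ≤⟨ *-monoʳ-≤ D (sum-filterᵇ-≤ injectiveB _ (unmatched rs ∘ ranks) S (allFuns S S)
           (λ rank inj → ranking-on-hard k N rank (injectiveB⁻ rank inj))) ⟩
    D * (S * L) ∎
    where
    open ≤-Reasoning
    S = suc k + N
    rs = roles (suc k) N
    D = suc N ^ suc k
    P = N ^ suc (suc k)
    A = totalRanking (hard (suc k) N)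
    L = length (allRankings S)
    U = sumL (List.map (unmatched rs ∘ ranks) (allRankings S))

open HardInstances

import Data.Integer as ℤ
import Data.Integer.Properties as ℤₚ
import Data.Nat as ℕ
import Data.Nat.Properties as ℕₚ
import Data.Rational as ℚ
import Data.Rational.Properties as ℚₚ
import Data.Rational.Unnormalised as ℚᵘ
import Data.Rational.Unnormalised.Properties as ℚᵘₚ
open import Data.Integer.Tactic.RingSolver using () renaming (solve-∀ to ℤ-solve-∀)
open import Data.List using (length)
open import Data.Nat using (zero; suc; s≤s; z≤n; _^_; NonZero)
open import Data.Nat.Tactic.RingSolver using (solve-∀)
open import Data.Product using (_,_)
open import Data.Rational using (ℚ; _+_; _*_; 0ℚ) renaming (_≤_ to _≤ℚ_; _<_ to _<ℚ_)
open import Relation.Binary.PropositionalEquality using (_≡_; sym; trans; cong; cong₂; subst)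

-- The ratio

toℚᵘ-/ℕ : ∀ a b → ℚ.toℚᵘ (a /ℕ suc b) ℚᵘ.≃ ℚᵘ.mkℚᵘ (ℤ.+ a) b
toℚᵘ-/ℕ a b = ℚₚ.toℚᵘ-fromℚᵘ (ℚᵘ.mkℚᵘ (ℤ.+ a) b)

-- Divides the hypothesis by q L. Unnormalised rationals reduce the comparison to
-- cross-multiplication of integers, and `NonZero` excludes the default value 0 of `/ℕ`.
ratio-bound : ∀ A L n p q .{{_ : NonZero L}} .{{_ : NonZero q}} →
  q ℕ.* A ℕ.+ p ℕ.* n ℕ.* L ≤ q ℕ.* n ℕ.* L → A /ℕ L ≤ℚ (ℚ.1ℚ ℚ.- p /ℕ q) * ℕtoℚ n
ratio-bound A (suc l) n p (suc q) hyp = ℚₚ.toℚᵘ-cancel-≤ (begin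
  ℚ.toℚᵘ (A /ℕ suc l)                  ≃⟨ toℚᵘ-/ℕ A l ⟩
  ℚᵘ.mkℚᵘ (ℤ.+ A) l                    ≤⟨ ℚᵘ.*≤* integers ⟩
  (ℚᵘ.1ℚᵘ ℚᵘ.- ℚᵘ.mkℚᵘ (ℤ.+ p) q) ℚᵘ.* ℚᵘ.mkℚᵘ (ℤ.+ n) 0
    ≃⟨ ℚᵘₚ.*-cong (ℚᵘₚ.+-congʳ ℚᵘ.1ℚᵘ (ℚᵘₚ.-‿cong (toℚᵘ-/ℕ p q))) (toℚᵘ-/ℕ n 0) ⟨
  (ℚᵘ.1ℚᵘ ℚᵘ.- ℚ.toℚᵘ (p /ℕ suc q)) ℚᵘ.* ℚ.toℚᵘ (ℕtoℚ n)
    ≃⟨ ℚᵘₚ.*-congʳ (ℚᵘₚ.+-congʳ ℚᵘ.1ℚᵘ (ℚₚ.toℚᵘ-homo‿- (p /ℕ suc q))) ⟨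
  (ℚᵘ.1ℚᵘ ℚᵘ.+ ℚ.toℚᵘ (ℚ.- (p /ℕ suc q))) ℚᵘ.* ℚ.toℚᵘ (ℕtoℚ n)
    ≃⟨ ℚᵘₚ.*-congʳ (ℚₚ.toℚᵘ-homo-+ ℚ.1ℚ (ℚ.- (p /ℕ suc q))) ⟨
  ℚ.toℚᵘ (ℚ.1ℚ ℚ.- p /ℕ suc q) ℚᵘ.* ℚ.toℚᵘ (ℕtoℚ n)
    ≃⟨ ℚₚ.toℚᵘ-homo-* (ℚ.1ℚ ℚ.- p /ℕ suc q) (ℕtoℚ n) ⟨
  ℚ.toℚᵘ ((ℚ.1ℚ ℚ.- p /ℕ suc q) * ℕtoℚ n) ∎)
  where
  open ℚᵘₚ.≤-Reasoning
  r = (ℚᵘ.1ℚᵘ ℚᵘ.- ℚᵘ.mkℚᵘ (ℤ.+ p) q) ℚᵘ.* ℚᵘ.mkℚᵘ (ℤ.+ n) 0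
  den : ℚᵘ.↧ r ≡ ℤ.+ suc q
  den = cong ℤ.+_ (trans (ℕₚ.*-identityʳ (1 ℕ.* suc q)) (ℕₚ.*-identityˡ (suc q)))
  num : ℚᵘ.↥ r ≡ (ℤ.+ suc q ℤ.- ℤ.+ p) ℤ.* ℤ.+ n
  num = cong (ℤ._* ℤ.+ n) (cong₂ ℤ._+_ (ℤₚ.*-identityˡ (ℤ.+ suc q)) (ℤₚ.*-identityʳ (ℤ.- ℤ.+ p)))
  pos-*₃ : ∀ x y z → ℤ.+ (x ℕ.* y ℕ.* z) ≡ ℤ.+ x ℤ.* ℤ.+ y ℤ.* ℤ.+ z
  pos-*₃ x y z = trans (ℤₚ.pos-* (x ℕ.* y) z) (cong (ℤ._* ℤ.+ z) (ℤₚ.pos-* x y))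
  cancel : ∀ x y → x ≡ x ℤ.+ y ℤ.- y
  cancel = ℤ-solve-∀
  factor : ∀ q p n l → q ℤ.* n ℤ.* l ℤ.- p ℤ.* n ℤ.* l ≡ (q ℤ.- p) ℤ.* n ℤ.* l
  factor = ℤ-solve-∀
  module ℤ-≤ = ℤₚ.≤-Reasoning
  integers : ℤ.+ A ℤ.* ℚᵘ.↧ r ℤ.≤ ℚᵘ.↥ r ℤ.* ℤ.+ suc l
  integers = ℤ-≤.begin
    ℤ.+ A ℤ.* ℚᵘ.↧ r
      ℤ-≤.≡⟨ trans (cong (ℤ.+ A ℤ.*_) den) (trans (ℤₚ.*-comm (ℤ.+ A) (ℤ.+ suc q)) (sym (ℤₚ.pos-* (suc q) A))) ⟩
    ℤ.+ (suc q ℕ.* A)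
      -- The term p n L is added and subtracted so that the hypothesis on naturals applies before
      -- the subtraction.
      ℤ-≤.≡⟨ cancel (ℤ.+ (suc q ℕ.* A)) (ℤ.+ (p ℕ.* n ℕ.* suc l)) ⟩
    ℤ.+ (suc q ℕ.* A ℕ.+ p ℕ.* n ℕ.* suc l) ℤ.- ℤ.+ (p ℕ.* n ℕ.* suc l)
      ℤ-≤.≤⟨ ℤₚ.+-monoˡ-≤ (ℤ.- ℤ.+ (p ℕ.* n ℕ.* suc l)) (ℤ.+≤+ hyp) ⟩
    ℤ.+ (suc q ℕ.* n ℕ.* suc l) ℤ.- ℤ.+ (p ℕ.* n ℕ.* suc l)
      ℤ-≤.≡⟨ cong₂ ℤ._-_ (pos-*₃ (suc q) n (suc l)) (pos-*₃ p n (suc l)) ⟩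
    ℤ.+ suc q ℤ.* ℤ.+ n ℤ.* ℤ.+ suc l ℤ.- ℤ.+ p ℤ.* ℤ.+ n ℤ.* ℤ.+ suc l
      ℤ-≤.≡⟨ factor (ℤ.+ suc q) (ℤ.+ p) (ℤ.+ n) (ℤ.+ suc l) ⟩
    (ℤ.+ suc q ℤ.- ℤ.+ p) ℤ.* ℤ.+ n ℤ.* ℤ.+ suc l
      ℤ-≤.≡⟨ cong (ℤ._* ℤ.+ suc l) num ⟨
    ℚᵘ.↥ r ℤ.* ℤ.+ suc l ℤ-≤.∎

-- Passes to the form with `ε` that expresses an upper bound on an infimum.
ratio-bound-+ : ∀ {x} b n ε → 0ℚ <ℚ ε → x ≤ℚ b * ℕtoℚ n → x ≤ℚ (b + ε) * ℕtoℚ n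
ratio-bound-+ b n ε 0<ε x≤ = ℚₚ.≤-trans x≤ (ℚₚ.*-monoʳ-≤-nonNeg (ℕtoℚ n) {{ℚₚ.normalize-nonNeg n 1}}
  (subst (_≤ℚ b + ε) (ℚₚ.+-identityʳ b) (ℚₚ.+-monoʳ-≤ b (ℚₚ.<⇒≤ 0<ε))))

-- The factor k + d - 1 in the denominator of `bound` is the number n of servers. Multiplying
-- `totalRanking-hard` by n therefore matches the two sides.
expectedRanking-hard : ∀ k N → let n = suc k ℕ.+ N in
  expectedRanking (hard (suc k) N) ≤ℚ bound (suc k) (suc N) * ℕtoℚ n
expectedRanking-hard k N = subst
  (λ m → expectedRanking (hard (suc k) N) ≤ℚ (ℚ.1ℚ ℚ.- ((N ^ suc k ℕ.* N) /ℕ (suc N ^ suc k ℕ.* m))) * ℕtoℚ n)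
  -- With d = N + 1 the truncated subtraction in `bound` removes exactly the successor contributed
  -- by d.
  (sym (cong (ℕ._∸ 1) (ℕₚ.+-suc (suc k) N)))
  (ratio-bound A L n p q {{L≢0}} {{ℕₚ.m*n≢0 D n {{ℕₚ.m^n≢0 (suc N) (suc k)}}}} (begin
    q ℕ.* A ℕ.+ p ℕ.* n ℕ.* L          ≡⟨ regroup D n A (N ^ suc k) N L ⟩
    n ℕ.* (D ℕ.* A ℕ.+ N ^ suc (suc k) ℕ.* L) ≤⟨ ℕₚ.*-monoʳ-≤ n (totalRanking-hard k N) ⟩
    n ℕ.* (D ℕ.* (n ℕ.* L))            ≡⟨ regroup′ D n L ⟩
    q ℕ.* n ℕ.* L                      ∎))
  where
  open ℕₚ.≤-Reasoning
  n = suc k ℕ.+ N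
  A = totalRanking (hard (suc k) N)
  L = length (allRankings n)
  D = suc N ^ suc k
  p = N ^ suc k ℕ.* N
  q = D ℕ.* n
  L≢0 : NonZero L
  L≢0 = ℕ.>-nonZero (subst (1 ≤_) (sym (length-allRankings n)) (injections-positive n))
  regroup : ∀ D n A P N L → D ℕ.* n ℕ.* A ℕ.+ P ℕ.* N ℕ.* n ℕ.* L ≡ n ℕ.* (D ℕ.* A ℕ.+ N ℕ.* P ℕ.* L)
  regroup = solve-∀
  regroup′ : ∀ D n L → n ℕ.* (D ℕ.* (n ℕ.* L)) ≡ D ℕ.* n ℕ.* n ℕ.* L
  regroup′ = solve-∀

theoremE1 : (k d : ℕ) → 2 ≤ d → d < k → (ε : ℚ) → 0ℚ <ℚ ε →
    Σ Instance λ I → Bounded k d I ×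
    Σ (Matching I) λ M → IsMaximum M × 1 ≤ size M ×
    expectedRanking I ≤ℚ (bound k d + ε) * ℕtoℚ (size M)
theoremE1 (suc (suc j)) (suc N) 2≤d d<k ε 0<ε =
  -- There are N = d - 1 targets, so a first-round request has degree d.
  hard k N , hard-bounded (suc j) N , M ,
  -- `M` covers every server, and no matching is larger than the number of servers.
  (λ M′ → ℕₚ.≤-trans (size≤servers M′) (ℕₚ.≤-reflexive (sym size-M))) ,
  subst (1 ≤_) (sym size-M) (s≤s z≤n) ,
  subst (λ m → expectedRanking (hard k N) ≤ℚ (bound k (suc N) + ε) * ℕtoℚ m) (sym size-M)
    (ratio-bound-+ (bound k (suc N)) (k ℕ.+ N) ε 0<ε (expectedRanking-hard (suc j) N))
  where
  k = suc (suc j)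
  N≤k : N ≤ k
  N≤k = ℕₚ.<⇒≤ (ℕₚ.<-trans (ℕₚ.n<1+n N) d<k)
  M = hard-matching j N N≤k
  size-M = size-hard-matching j N N≤k
theoremE1 (suc zero) (suc N) 2≤d (s≤s ()) ε 0<ε
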